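{- Let $n\ge 2$ and $1\le k<n$, and let $G=H_B(n,k)$. Then: (i) every vertex of $V_1$ has degree $d_{V_1}(k)=\sum_{s=1}^{k}2^{s-1}\binom{k}{s}-1+\sum_{t=1}^{n-k}2^{k+t-1}\binom{n-k}{t}=\frac{3^k-3}{2}+2^{k-1}(3^{n-k}-1)$, and there are $\binom{n}{k}$ such vertices; (ii) for $1\le r<k$, every $r$-vertex of $V_2$ has degree $\binom{n-r}{k-r}$, and there are $2^{r-1}\binom{n}{r}$ such vertices; (iii) every $k$-vertex of $V_2$ has degree $1$, and there are $(2^{k-1}-1)\binom{n}{k}$ such vertices; (iv) for $k<r\le n$, every $r$-vertex of $V_2$ has degree $\binom{r}{k}$, and there are $2^{r-1}\binom{n}{r}$ such vertices. Consequently the degree sequence of $G$ is obtained by arranging these degrees, each repeated with the stated multiplicity, in non-increasing order.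
   Context: Fix integers $n\ge 2$ and $1\le k<n$ and positive real numbers $x_1<x_2<\dots<x_n$. Let $\mathscr{B}_n=\{\pm x_1,\pm x_2,\dots,\pm x_{n-1},x_n\}$ (so $-x_n\notin\mathscr{B}_n$). Let $\phi(\mathscr{B}_n)$ be the family of all nonempty subsets $S\subseteq\mathscr{B}_n$ whose elements have pairwise distinct absolute values and whose element of largest absolute value is positive. Let $\mathscr{B}_n^+=\{x_1,\dots,x_n\}$, let $V_1$ be the set of all $k$-element subsets of $\mathscr{B}_n^+$, and let $V_2=\phi(\mathscr{B}_n)\setminus V_1$. For $A\in\phi(\mathscr{B}_n)$ put $A^\dagger=\{|a|:a\in A\}$. The bipartite Kneser B type-$k$ graph $H_B(n,k)$ is the simple graph with vertex set $V_1\cup V_2$ in which $X\in V_1$ and $Y\in V_2$ are adjacent if and only if $X\subseteq Y^\dagger$ or $Y^\dagger\subseteq X$, and there are no other edges. An $r$-vertex is a vertex having exactly $r$ elements. -}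

module Defs where

open import Level using (0ℓ)
open import Data.Nat.Base as ℕ using (ℕ; suc; _+_; _*_; _^_; _∸_)
open import Data.Nat.Combinatorics using (_C_)
open import Data.Nat.ListAction using (sum)
open import Data.Nat.Properties using (m∸n≤m)
open import Data.Rational.Base as ℚ using (ℚ; 0ℚ)
import Data.Rational.Properties as ℚ
import Algebra.Properties.Group ℚ.+-0-group as ℚ-Group
open import Data.Fin.Base using (inject≤)
open import Data.Fin.Subset using (Subset; Nonempty; ∣_∣; _∈_)
open import Data.Vec.Functional using (Vector; _++_)
open import Data.List.Base
  using (List; length; applyUpTo; map; concatMap; replicate) renaming (_++_ to _++ˡ_)
open import Data.List.Membership.Propositional using () renaming (_∈_ to _∈ˡ_)
open import Data.List.Relation.Unary.Linked using (Linked)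
open import Data.List.Relation.Unary.Unique.Propositional using (Unique)
open import Data.List.Relation.Binary.Pointwise using (Pointwise)
open import Data.Product.Base using (∃; _×_; _,_)
open import Data.Sum.Base using (_⊎_; inj₁; inj₂; swap)
open import Function.Bundles using (_⇔_)
open import Relation.Binary.Core using (Rel)
open import Relation.Binary.Definitions using (Symmetric)
open import Relation.Binary.PropositionalEquality
  using (_≡_; refl; sym; trans; cong; subst; subst₂)
open import Relation.Nullary using (¬_)
open import Relation.Unary using (Pred; _⊆_)

-- Real numbers are Cauchy sequences of rationals; equality of reals is _≃_, not _≡_.

IsCauchy : (ℕ → ℚ) → Set
IsCauchy s = ∀ ε → 0ℚ ℚ.< ε → ∃ λ N → ∀ m n → N ℕ.≤ m → N ℕ.≤ n →
             ℚ.∣ s m ℚ.- s n ∣ ℚ.< ε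

record ℝ : Set where
  constructor mkℝ
  field
    seq    : ℕ → ℚ
    cauchy : IsCauchy seq

open ℝ public

infix 4 _≃_ _<ℝ_ _≤ℝ_
infix 8 -ℝ_

_≃_ : Rel ℝ 0ℓ
x ≃ y = ∀ ε → 0ℚ ℚ.< ε → ∃ λ N → ∀ n → N ℕ.≤ n → ℚ.∣ seq x n ℚ.- seq y n ∣ ℚ.< ε

_<ℝ_ : Rel ℝ 0ℓ
x <ℝ y = ∃ λ ε → 0ℚ ℚ.< ε × ∃ λ N → ∀ n → N ℕ.≤ n → seq x n ℚ.+ ε ℚ.< seq y n

_≤ℝ_ : Rel ℝ 0ℓ
x ≤ℝ y = ¬ (y <ℝ x)

0ℝ : ℝ
0ℝ = mkℝ (λ _ → 0ℚ) (λ ε 0<ε → 0 , λ _ _ _ _ → 0<ε)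

private
  diff-neg : ∀ p q → ℚ.∣ (ℚ.- p) ℚ.- (ℚ.- q) ∣ ≡ ℚ.∣ p ℚ.- q ∣
  diff-neg p q = trans (cong ℚ.∣_∣ (sym (ℚ.neg-distrib-+ p (ℚ.- q)))) (ℚ.∣-p∣≡∣p∣ (p ℚ.- q))

  diff-swap : ∀ p q → ℚ.- (p ℚ.- q) ≡ q ℚ.- p
  diff-swap p q = trans (ℚ.neg-distrib-+ p (ℚ.- q))
    (trans (cong (ℚ.- p ℚ.+_) (ℚ-Group.⁻¹-involutive q)) (ℚ.+-comm (ℚ.- p) q))

  cancelʳ : ∀ p q → (p ℚ.- q) ℚ.+ q ≡ p
  cancelʳ p q = trans (ℚ.+-assoc p (ℚ.- q) q)
    (trans (cong (p ℚ.+_) (ℚ.+-inverseˡ q)) (ℚ.+-identityʳ p))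

  cancelʳ′ : ∀ p q → (p ℚ.+ q) ℚ.- q ≡ p
  cancelʳ′ p q = trans (ℚ.+-assoc p q (ℚ.- q))
    (trans (cong (p ℚ.+_) (ℚ.+-inverseʳ q)) (ℚ.+-identityʳ p))

  abs-diff₁ : ∀ p q → ℚ.∣ p ∣ ℚ.- ℚ.∣ q ∣ ℚ.≤ ℚ.∣ p ℚ.- q ∣
  abs-diff₁ p q = subst (ℚ.∣ p ∣ ℚ.- ℚ.∣ q ∣ ℚ.≤_) (cancelʳ′ ℚ.∣ p ℚ.- q ∣ ℚ.∣ q ∣)
    (ℚ.+-monoˡ-≤ (ℚ.- ℚ.∣ q ∣)
      (subst (λ r → ℚ.∣ r ∣ ℚ.≤ ℚ.∣ p ℚ.- q ∣ ℚ.+ ℚ.∣ q ∣) (cancelʳ p q)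
        (ℚ.∣p+q∣≤∣p∣+∣q∣ (p ℚ.- q) q)))

  abs-diff : ∀ p q → ℚ.∣ ℚ.∣ p ∣ ℚ.- ℚ.∣ q ∣ ∣ ℚ.≤ ℚ.∣ p ℚ.- q ∣
  abs-diff p q with ℚ.∣p∣≡p∨∣p∣≡-p (ℚ.∣ p ∣ ℚ.- ℚ.∣ q ∣)
  ... | inj₁ eq = subst (ℚ._≤ ℚ.∣ p ℚ.- q ∣) (sym eq) (abs-diff₁ p q)
  ... | inj₂ eq = subst₂ ℚ._≤_
          (sym (trans eq (diff-swap ℚ.∣ p ∣ ℚ.∣ q ∣)))
          (trans (sym (ℚ.∣-p∣≡∣p∣ (q ℚ.- p))) (cong ℚ.∣_∣ (diff-swap q p)))
          (abs-diff₁ q p)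

-ℝ_ : ℝ → ℝ
-ℝ x = mkℝ (λ n → ℚ.- seq x n) λ ε 0<ε →
  let N , close = cauchy x ε 0<ε in
  N , λ m n N≤m N≤n →
    subst (ℚ._< ε) (sym (diff-neg (seq x m) (seq x n))) (close m n N≤m N≤n)

abs : ℝ → ℝ
abs x = mkℝ (λ n → ℚ.∣ seq x n ∣) λ ε 0<ε →
  let N , close = cauchy x ε 0<ε in
  N , λ m n N≤m N≤n → ℚ.≤-<-trans (abs-diff (seq x m) (seq x n)) (close m n N≤m N≤n)

record _Enumerates_ {A : Set} (as : List A) (P : Pred A 0ℓ) : Set where
  field
    unique   : Unique as
    contains : ∀ a → (a ∈ˡ as) ⇔ P a

_HasCardinality_ : {A : Set} → Pred A 0ℓ → ℕ → Set
P HasCardinality m = ∃ λ as → as Enumerates P × length as ≡ m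

-- range a b = a ∷ a + 1 ∷ … ∷ b ∷ [], empty when b < a
range : ℕ → ℕ → List ℕ
range a b = applyUpTo (a +_) (suc b ∸ a)

NonIncreasing : List ℕ → Set
NonIncreasing = Linked ℕ._≥_

-- The vertex set is a subset of A, so that vertices are compared by _≡_ on A.
record SimpleGraph (A : Set) : Set₁ where
  infix 4 _~_
  field
    IsVertex  : Pred A 0ℓ
    _~_       : Rel A 0ℓ
    ~⇒vertex  : ∀ {u v} → u ~ v → IsVertex u × IsVertex v
    ~-sym     : Symmetric _~_
    ~-irrefl  : ∀ {v} → ¬ (v ~ v)

  HasDegree : A → ℕ → Set
  HasDegree v d = (v ~_) HasCardinality d

  IsDegreeSequence : List ℕ → Set
  IsDegreeSequence ds =
    NonIncreasing ds × ∃ λ vs → vs Enumerates IsVertex × Pointwise HasDegree vs ds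

-- The values x zero, x (suc zero), … are x₁, x₂, ….  Since x₁, …, xₙ, -x₁, …, -xₙ₋₁ are
-- pairwise distinct when 0 < x₁ < … < xₙ, a subset of 𝓑ₙ is given by the subset of the
-- index set Fin (n + (n ∸ 1)) of its elements, with the same number of elements.

module _ {n : ℕ} (x : Vector ℝ n) where

  𝓑 : Vector ℝ (n + (n ∸ 1))
  𝓑 = x ++ λ i → -ℝ x (inject≤ i (m∸n≤m n 1))

  𝓑⁺ : Pred ℝ 0ℓ
  𝓑⁺ z = ∃ λ i → z ≃ x i

  Sub𝓑 : Set
  Sub𝓑 = Subset (n + (n ∸ 1))

  ⟦_⟧ : Sub𝓑 → Pred ℝ 0ℓ
  ⟦ S ⟧ z = ∃ λ i → i ∈ S × z ≃ 𝓑 i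

  _† : Sub𝓑 → Pred ℝ 0ℓ
  (S †) z = ∃ λ i → i ∈ S × z ≃ abs (𝓑 i)

  record φ (S : Sub𝓑) : Set where
    field
      nonempty     : Nonempty S
      distinct-abs : ∀ {i j} → i ∈ S → j ∈ S → abs (𝓑 i) ≃ abs (𝓑 j) → i ≡ j
      max-positive : ∃ λ i → i ∈ S × (∀ {j} → j ∈ S → abs (𝓑 j) ≤ℝ abs (𝓑 i)) × 0ℝ <ℝ 𝓑 i

  module _ (k : ℕ) where

    V₁ : Pred Sub𝓑 0ℓ
    V₁ S = ⟦ S ⟧ ⊆ 𝓑⁺ × ∣ S ∣ ≡ k

    V₂ : Pred Sub𝓑 0ℓ
    V₂ S = φ S × ¬ V₁ S

    Adj₁₂ : Rel Sub𝓑 0ℓ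
    Adj₁₂ X Y = V₁ X × V₂ Y × (⟦ X ⟧ ⊆ Y † ⊎ Y † ⊆ ⟦ X ⟧)

    H-B : SimpleGraph Sub𝓑
    H-B = record
      { IsVertex = λ S → V₁ S ⊎ V₂ S
      ; _~_      = λ S T → Adj₁₂ S T ⊎ Adj₁₂ T S
      ; ~⇒vertex = λ { (inj₁ (p , q , _)) → inj₁ p , inj₂ q
                     ; (inj₂ (p , q , _)) → inj₂ q , inj₁ p }
      ; ~-sym    = swap
      ; ~-irrefl = λ { (inj₁ (p , (_ , ¬p) , _)) → ¬p p
                     ; (inj₂ (p , (_ , ¬p) , _)) → ¬p p }
      }

-- The degree of the vertices in V₁.  For k ≥ 1 the first sum is at least 1, so the
-- truncated subtraction is exact.
d-V₁ : ℕ → ℕ → ℕ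
d-V₁ n k = (sum (map (λ s → 2 ^ (s ∸ 1) * (k C s)) (range 1 k)) ∸ 1)
         + sum (map (λ t → 2 ^ (k + t ∸ 1) * ((n ∸ k) C t)) (range 1 (n ∸ k)))

-- The degrees of all vertices with multiplicities: those of V₁, then those of the
-- r-vertices of V₂ with 1 ≤ r < k, r = k and k < r ≤ n.
degreeList : ℕ → ℕ → List ℕ
degreeList n k =
     replicate (n C k) (d-V₁ n k)
  ++ˡ concatMap (λ r → replicate (2 ^ (r ∸ 1) * (n C r)) ((n ∸ r) C (k ∸ r))) (range 1 (k ∸ 1))
  ++ˡ replicate ((2 ^ (k ∸ 1) ∸ 1) * (n C k)) 1
  ++ˡ concatMap (λ r → replicate (2 ^ (r ∸ 1) * (n C r)) (r C k)) (range (suc k) n)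

{-# OPTIONS --safe #-}

-- Negating elements does not change absolute values, so a vertex Y is determined by its support
-- Y† together with the set of its negative elements; the latter is an arbitrary subset of the
-- support without its maximum.  A support with r elements therefore carries 2^(r-1) vertices,
-- and adjacency only depends on the support.  Hence every count is a binomial coefficient for the
-- supports times a power of 2 for the signs, and the closed form in (i) is Σ 2^s C(k,s) = 3^k.
module Submission where

open import Defs
open import Level using (0ℓ)
open import Data.Bool.Properties using (not-involutive) renaming (_≟_ to _≟ᵇ_)
open import Data.Empty using (⊥-elim)
open import Data.Fin.Base as Fin using (Fin; zero; suc; inject₁; splitAt; _↑ˡ_; _↑ʳ_)
open import Data.Fin.Properties as Fin
  using (splitAt-↑ˡ; splitAt-↑ʳ; join-splitAt; toℕ-injective; toℕ-inject≤; toℕ-inject₁;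
         inject₁-injective)
open import Data.Fin.Subset
  using (Subset; Side; inside; outside; ⊥; ⊤; ∁; ∣_∣; _∈_; _∉_; _⊆_; _∪_; Empty)
open import Data.Fin.Subset.Properties
open import Data.List.Base
  using (List; []; _∷_; _∷ʳ_; length; map; concatMap; replicate; filter; applyUpTo)
  renaming (_++_ to _++ˡ_)
open import Data.List.Membership.Propositional using () renaming (_∈_ to _∈ˡ_)
open import Data.List.Membership.Propositional.Properties
  using (∈-map⁺; ∈-map⁻; ∈-++⁺ˡ; ∈-++⁺ʳ; ∈-++⁻; ∈-filter⁺; ∈-filter⁻; ∈-applyUpTo⁺; ∈-applyUpTo⁻)
open import Data.List.Membership.Propositional.Properties.WithK using (unique∧set⇒bag)
open import Data.List.Properties
  using (length-++; length-map; length-replicate; map-applyUpTo; applyUpTo-∷ʳ)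
open import Data.List.Relation.Binary.BagAndSetEquality using (∼bag⇒↭)
open import Data.List.Relation.Binary.Permutation.Propositional
  using (_↭_; refl; prep; swap; ↭-sym; ↭-trans; ↭⇒↭ₛ)
open import Data.List.Relation.Binary.Permutation.Propositional.Properties using (↭-length; ∈-resp-↭)
import Data.List.Relation.Binary.Permutation.Setoid.Properties as Permutation
open import Data.List.Relation.Binary.Pointwise as Pointwise using (Pointwise; []; _∷_)
open import Data.List.Relation.Unary.All as All using ([]; _∷_)
open import Data.List.Relation.Unary.AllPairs using ([]; _∷_)
open import Data.List.Relation.Unary.Any using (here; there)
open import Data.List.Relation.Unary.Unique.Propositional using (Unique)
import Data.List.Relation.Unary.Unique.Propositional.Properties as Unique
open import Data.Nat.Base
  using (ℕ; zero; suc; _+_; _*_; _∸_; _^_; _/_; _⊔_; _≤_; _<_; z≤n; s≤s; s≤s⁻¹)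
open import Data.Nat.Combinatorics
  using (_C_; nCk+nC[k+1]≡[n+1]C[k+1]; nCk≡nC[n∸k]; nCn≡1; k>n⇒nCk≡0)
open import Data.Nat.DivMod using (m*n/n≡m)
open import Data.Nat.ListAction using (sum)
open import Data.Nat.ListAction.Properties using (sum-++)
open import Data.Nat.Properties
open import Data.Nat.Solver using (module +-*-Solver)
open import Data.Product.Base using (∃; _×_; _,_; proj₁; proj₂; map₂)
open import Data.Rational.Base as ℚ using (0ℚ)
import Data.Rational.Properties as ℚ
open import Algebra.Properties.AbelianGroup ℚ.+-0-abelianGroup using (⁻¹-anti-homo-∙)
open import Algebra.Properties.Group ℚ.+-0-group using (⁻¹-involutive)
open import Data.Sum.Base using (_⊎_; inj₁; inj₂; [_,_]′)
import Data.Unit.Base as Unit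
open import Data.Vec.Base as Vec using ([]; _∷_; here; there; _++_)
open import Data.Vec.Functional using (Vector)
open import Data.Vec.Properties
  using (∷-injectiveʳ; map-id; map-∘; map-cong; take++drop≡id; ++-injectiveˡ; ++-injectiveʳ; ≡-dec)
open import Function.Base using (_∘_; id; const)
open import Function.Bundles using (_⇔_; mk⇔; Equivalence)
open import Relation.Binary.Definitions using (tri<; tri≈; tri>)
open import Relation.Binary.PropositionalEquality
  using (_≡_; _≢_; _≗_; refl; sym; trans; cong; cong₂; subst; subst₂; setoid; module ≡-Reasoning)
open import Relation.Nullary using (¬_; yes; no; contradiction)
open import Relation.Nullary.Decidable using (¬?; _×-dec_) renaming (map to map-dec)
open import Relation.Unary using (Pred; Decidable) renaming (_⊆_ to _⊆ᵖ_)

open Equivalence using (to; from)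
open _Enumerates_

-- Enumerations and cardinalities

-- The obstacle is that order and equality of Cauchy reals are undecidable, while counting needs
-- exact, decidable data. Strict monotonicity of `x` moves every comparison to indices, where
-- trichotomy is available: the sequence of `abs (𝓑 x i)` eventually coincides with that of
-- `x (index i)`. Thus `φ`, `V₁` and both inclusions in the adjacency become statements about `pos`,
-- `neg` and `supp`, and the counting takes place on subsets of indices.
--
-- The `- 1` in (i) is the vertex `X` itself, the only member of `V₁` whose support lies inside that
-- of `X`. A vertex of `V₂` with the same support as `X` satisfies both inclusions; it is counted
-- with the smaller supports, which is why the second sum starts at `t = 1`.

private
  variable
    A B I : Set
    P Q : Pred A 0ℓ

enumerates-resp : {as : List A} → (∀ a → P a ⇔ Q a) → as Enumerates P → as Enumerates Q
enumerates-resp P⇔Q e = record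
  { unique   = unique e
  ; contains = λ a → mk⇔ (to (P⇔Q a) ∘ to (contains e a)) (from (contains e a) ∘ from (P⇔Q a))
  }

-- Membership proofs in a duplicate-free list are unique, so agreement as sets is already agreement
-- as bags. This makes cardinalities, and hence degrees, well defined.
enumerates-↭ : {as as′ : List A} → as Enumerates P → as′ Enumerates P → as ↭ as′
enumerates-↭ e e′ = ∼bag⇒↭ (unique∧set⇒bag (unique e) (unique e′) λ {a} →
  mk⇔ (from (contains e′ a) ∘ to (contains e a)) (from (contains e a) ∘ to (contains e′ a)))

↭-enumerates : {as as′ : List A} → as ↭ as′ → as Enumerates P → as′ Enumerates P
↭-enumerates as↭ e = record
  { unique   = Permutation.Unique-resp-↭ (setoid _) (↭⇒↭ₛ as↭) (unique e)
  ; contains = λ a → mk⇔ (to (contains e a) ∘ ∈-resp-↭ (↭-sym as↭)) (∈-resp-↭ as↭ ∘ from (contains e a))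
  }

enumerates-⊎ : {as bs : List A} → as Enumerates P → bs Enumerates Q →
               (∀ a → P a → ¬ Q a) → (as ++ˡ bs) Enumerates (λ a → P a ⊎ Q a)
enumerates-⊎ {as = as} e e′ disjoint = record
  { unique   = Unique.++⁺ (unique e) (unique e′)
                 λ { (a∈as , a∈bs) → disjoint _ (to (contains e _) a∈as) (to (contains e′ _) a∈bs) }
  ; contains = λ a → mk⇔
      (λ a∈ → case-⊎ a (∈-++⁻ as a∈))
      λ { (inj₁ p) → ∈-++⁺ˡ (from (contains e a) p) ; (inj₂ q) → ∈-++⁺ʳ as (from (contains e′ a) q) }
  }
  where
  case-⊎ : ∀ a → a ∈ˡ as ⊎ a ∈ˡ _ → _
  case-⊎ a (inj₁ a∈as) = inj₁ (to (contains e a) a∈as)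
  case-⊎ a (inj₂ a∈bs) = inj₂ (to (contains e′ a) a∈bs)

enumerates-map : {as : List A} (f : A → B) → (∀ {a a′} → f a ≡ f a′ → a ≡ a′) →
                 as Enumerates P → map f as Enumerates (λ b → ∃ λ a → P a × b ≡ f a)
enumerates-map f f-inj e = record
  { unique   = Unique.map⁺ f-inj (unique e)
  ; contains = λ b → mk⇔
      (λ b∈ → let a , a∈ , b≡ = ∈-map⁻ f b∈ in a , to (contains e a) a∈ , b≡)
      λ { (a , p , refl) → ∈-map⁺ f (from (contains e a) p) }
  }

enumerates-filter : {as : List A} (Q? : Decidable Q) → as Enumerates P →
                    filter Q? as Enumerates (λ a → P a × Q a)
enumerates-filter Q? e = record
  { unique   = Unique.filter⁺ Q? (unique e)
  ; contains = λ a → mk⇔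
      (λ a∈ → let a∈as , q = ∈-filter⁻ Q? a∈ in to (contains e a) a∈as , q)
      (λ (p , q) → ∈-filter⁺ Q? (from (contains e a) p) q)
  }

enumerates-[] : (∀ a → ¬ P a) → [] Enumerates P
enumerates-[] ¬P = record { unique = [] ; contains = λ a → mk⇔ (λ ()) (⊥-elim ∘ ¬P a) }

card-resp : ∀ {m} → (∀ a → P a ⇔ Q a) → P HasCardinality m → Q HasCardinality m
card-resp P⇔Q (as , e , len) = as , enumerates-resp P⇔Q e , len

card-≡ : ∀ {m n} → m ≡ n → P HasCardinality m → P HasCardinality n
card-≡ refl = id

card-unique : ∀ {m n} → P HasCardinality m → P HasCardinality n → m ≡ n
card-unique (as , e , refl) (as′ , e′ , refl) = ↭-length (enumerates-↭ e e′)

card-zero : (∀ a → ¬ P a) → P HasCardinality 0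
card-zero ¬P = [] , enumerates-[] ¬P , refl

card-singleton : (a : A) → (∀ b → P b ⇔ b ≡ a) → P HasCardinality 1
card-singleton a P⇔≡ = a ∷ [] , record
  { unique   = [] ∷ []
  ; contains = λ b → mk⇔ (λ { (here b≡a) → from (P⇔≡ b) b≡a ; (there ()) }) (here ∘ to (P⇔≡ b))
  } , refl

card-⊎ : ∀ {m n} → P HasCardinality m → Q HasCardinality n →
         (∀ a → P a → ¬ Q a) → (λ a → P a ⊎ Q a) HasCardinality (m + n)
card-⊎ (as , e , refl) (bs , e′ , refl) disjoint =
  as ++ˡ bs , enumerates-⊎ e e′ disjoint , length-++ as

card-map : ∀ {m} (f : A → B) → (∀ {a a′} → f a ≡ f a′ → a ≡ a′) → P HasCardinality m →
           (λ b → ∃ λ a → P a × b ≡ f a) HasCardinality m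
card-map f f-inj (as , e , len) = map f as , enumerates-map f f-inj e , trans (length-map f as) len

-- The truncated subtraction is exact: `Q` together with the filtered rest enumerates `P`, and
-- cardinalities are unique.
card-∖ : ∀ {m n} → Decidable Q → (∀ a → Q a → P a) → P HasCardinality m → Q HasCardinality n →
         (λ a → P a × ¬ Q a) HasCardinality (m ∸ n)
card-∖ {Q = Q} {P = P} {m = m} {n = n} Q? Q⊆P P-card@(as , e , _) Q-card =
  rest , rest-enum , (begin
    length rest            ≡⟨ m+n∸m≡n n (length rest) ⟨
    n + length rest ∸ n    ≡⟨ cong (_∸ n) (card-unique Q⊎rest P-card) ⟩
    m ∸ n                  ∎)
  where
  open ≡-Reasoning
  rest = filter (¬? ∘ Q?) as
  rest-enum = enumerates-filter (¬? ∘ Q?) e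

  split : ∀ a → (Q a ⊎ (P a × ¬ Q a)) ⇔ P a
  split a = mk⇔ (λ { (inj₁ q) → Q⊆P a q ; (inj₂ (p , _)) → p }) back
    where
    back : P a → Q a ⊎ (P a × ¬ Q a)
    back p with Q? a
    ... | yes q = inj₁ q
    ... | no ¬q = inj₂ (p , ¬q)

  Q⊎rest : P HasCardinality (n + length rest)
  Q⊎rest = card-resp split (card-⊎ Q-card (rest , rest-enum , refl) λ _ q (_ , ¬q) → ¬q q)

pointwise-↭ : {R : A → B → Set} {as as′ : List A} {bs : List B} → as ↭ as′ → Pointwise R as bs →
              ∃ λ bs′ → Pointwise R as′ bs′ × bs ↭ bs′
pointwise-↭ refl                pw           = _ , pw , refl
pointwise-↭ (prep _ as↭)        (r ∷ pw)     =
  let _ , pw′ , bs↭ = pointwise-↭ as↭ pw in _ , r ∷ pw′ , prep _ bs↭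
pointwise-↭ (swap _ _ as↭)      (r ∷ s ∷ pw) =
  let _ , pw′ , bs↭ = pointwise-↭ as↭ pw in _ , s ∷ r ∷ pw′ , swap _ _ bs↭
pointwise-↭ (_↭_.trans as↭ as↭′) pw         =
  let _ , pw′ , bs↭ = pointwise-↭ as↭ pw ; _ , pw″ , bs↭′ = pointwise-↭ as↭′ pw′ in
  _ , pw″ , ↭-trans bs↭ bs↭′

pointwise-functional : {R : A → B → Set} → (∀ {a b c} → R a b → R a c → b ≡ c) →
                       ∀ {as bs cs} → Pointwise R as bs → Pointwise R as cs → bs ≡ cs
pointwise-functional R-fun []       []         = refl
pointwise-functional R-fun (r ∷ pw) (r′ ∷ pw′) =
  cong₂ _∷_ (R-fun r r′) (pointwise-functional R-fun pw pw′)

-- At `R = HasDegree` and `P = IsVertex` this is the second half of `IsDegreeSequence`; in this form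
-- a degree list can be assembled block by block.
Labelled : (A → B → Set) → Pred A 0ℓ → List B → Set
Labelled R P bs = ∃ λ as → as Enumerates P × Pointwise R as bs

module _ {R : A → B → Set} where

  labelled-resp : ∀ {bs} → (∀ a → P a ⇔ Q a) → Labelled R P bs → Labelled R Q bs
  labelled-resp P⇔Q (as , e , pw) = as , enumerates-resp P⇔Q e , pw

  labelled-⊎ : ∀ {bs cs} → Labelled R P bs → Labelled R Q cs →
               (∀ a → P a → ¬ Q a) → Labelled R (λ a → P a ⊎ Q a) (bs ++ˡ cs)
  labelled-⊎ (as , e , pw) (as′ , e′ , pw′) disjoint =
    as ++ˡ as′ , enumerates-⊎ e e′ disjoint , Pointwise.++⁺ pw pw′

  labelled-replicate : ∀ {m b} → P HasCardinality m → (∀ a → P a → R a b) →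
                       Labelled R P (replicate m b)
  labelled-replicate {b = b} (as , e , refl) r = as , e , go as λ a∈ → r _ (to (contains e _) a∈)
    where
    go : ∀ as → (∀ {a} → a ∈ˡ as → R a b) → Pointwise R as (replicate (length as) b)
    go []       f = []
    go (a ∷ as) f = f (here refl) ∷ go as (f ∘ there)

  labelled-⋃ : {Q : I → Pred A 0ℓ} (g : I → List B) (is : List I) → Unique is →
               (∀ {i} → i ∈ˡ is → Labelled R (Q i) (g i)) →
               (∀ {i j} a → Q i a → Q j a → i ≡ j) →
               Labelled R (λ a → ∃ λ i → i ∈ˡ is × Q i a) (concatMap g is)
  labelled-⋃ g []       _          _   _        = [] , enumerates-[] (λ { _ (_ , () , _) }) , []
  labelled-⋃ {Q = Q} g (i ∷ is) (i∉is ∷ u) lab disjoint = labelled-resp regroup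
    (labelled-⊎ (lab (here refl)) (labelled-⋃ g is u (lab ∘ there) disjoint)
      λ { a q (j , j∈is , q′) → All.lookup i∉is j∈is (disjoint a q q′) })
    where
    regroup : ∀ a → (Q i a ⊎ ∃ λ j → j ∈ˡ is × Q j a) ⇔ (∃ λ j → j ∈ˡ (i ∷ is) × Q j a)
    regroup a = mk⇔
      (λ { (inj₁ q) → i , here refl , q ; (inj₂ (j , j∈ , q)) → j , there j∈ , q })
      λ { (j , here refl , q) → inj₁ q ; (j , there j∈ , q) → inj₂ (j , j∈ , q) }

  -- Two enumerations of `P` differ by a permutation; the labels travel along it, and functionality
  -- of `R` identifies them with the second list.
  labelled-unique : (∀ {a b c} → R a b → R a c → b ≡ c) → ∀ {bs cs} →
                    Labelled R P bs → Labelled R P cs → bs ↭ cs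
  labelled-unique R-fun (as , e , pw) (as′ , e′ , pw′) =
    let bs′ , pw″ , bs↭ = pointwise-↭ (enumerates-↭ e e′) pw in
    subst (_ ↭_) (pointwise-functional R-fun pw″ pw′) bs↭

  labelled-↭ : ∀ {bs cs} → bs ↭ cs → Labelled R P bs → Labelled R P cs
  labelled-↭ bs↭cs (as , e , pw) =
    -- Here the labels are permuted and the enumerated elements have to follow, so the relation is
    -- flipped before and after.
    let as′ , pw′ , as↭ = pointwise-↭ bs↭cs (Pointwise.symmetric id pw) in
    as′ , ↭-enumerates as↭ e , Pointwise.symmetric id pw′

card-⋃ : {Q : I → Pred A 0ℓ} (f : I → ℕ) (is : List I) → Unique is →
         (∀ {i} → i ∈ˡ is → Q i HasCardinality f i) →
         (∀ {i j} a → Q i a → Q j a → i ≡ j) →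
         (λ a → ∃ λ i → i ∈ˡ is × Q i a) HasCardinality sum (map f is)
card-⋃ {I = I} {A = A} f is u card disjoint =
  -- With labels in the unit type the label list records nothing but its length.
  let as , e , pw = labelled-⋃ {R = λ (_ : A) (_ : Unit.⊤) → Unit.⊤} (λ i → replicate (f i) Unit.tt) is u
                      (λ i∈ → labelled-replicate (card i∈) _) disjoint
  in as , e , trans (Pointwise.Pointwise-length pw) (length-concatMap is)
  where
  length-concatMap : ∀ is → length (concatMap (λ i → replicate (f i) Unit.tt) is) ≡ sum (map f is)
  length-concatMap []       = refl
  length-concatMap (i ∷ is) = trans (length-++ (replicate (f i) Unit.tt))
    (cong₂ _+_ (length-replicate (f i)) (length-concatMap is))

card-fibration : ∀ {m n} (f : A → B) → Q HasCardinality m →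
                 (∀ {b} → Q b → (λ a → P a × f a ≡ b) HasCardinality n) →
                 (λ a → P a × Q (f a)) HasCardinality (m * n)
card-fibration {Q = Q} {P = P} {n = n} f (bs , e , refl) card =
  card-≡ (sum-const bs) (card-resp regroup
    (card-⋃ (const n) bs (unique e) (card ∘ to (contains e _))
      λ { a (_ , refl) (_ , refl) → refl }))
  where
  regroup : ∀ a → (∃ λ b → b ∈ˡ bs × P a × f a ≡ b) ⇔ (P a × Q (f a))
  regroup a = mk⇔ (λ { (_ , b∈ , p , refl) → p , to (contains e _) b∈ })
                  λ (p , q) → f a , from (contains e _) q , p , refl

  sum-const : ∀ bs → sum (map (const n) bs) ≡ length bs * n
  sum-const []       = refl
  sum-const (b ∷ bs) = cong (n +_) (sum-const bs)

-- Counting subsets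

∣p∣≡0⇒p≡⊥ : ∀ {n} {p : Subset n} → ∣ p ∣ ≡ 0 → p ≡ ⊥
∣p∣≡0⇒p≡⊥ {p = p} ∣p∣≡0 = Empty-unique λ (i , i∈p) → <⇒≱ (x∈p⇒∣p-x∣<∣p∣ i∈p) (≤-trans (≤-reflexive ∣p∣≡0) z≤n)

-- Collapses the disjunction in the adjacency: when the sizes are the wrong way round for an
-- inclusion, it can only be an equality.
⊆∧∣≥∣⇒≡ : ∀ {n} {p q : Subset n} → p ⊆ q → ∣ q ∣ ≤ ∣ p ∣ → p ≡ q
⊆∧∣≥∣⇒≡ {p = []}          {[]}          _   _   = refl
⊆∧∣≥∣⇒≡ {p = outside ∷ p} {outside ∷ q} p⊆q q≤p = cong (outside ∷_) (⊆∧∣≥∣⇒≡ (drop-∷-⊆ p⊆q) q≤p)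
⊆∧∣≥∣⇒≡ {p = inside  ∷ p} {inside  ∷ q} p⊆q (s≤s q≤p) = cong (inside ∷_) (⊆∧∣≥∣⇒≡ (drop-∷-⊆ p⊆q) q≤p)
⊆∧∣≥∣⇒≡ {p = outside ∷ p} {inside  ∷ q} p⊆q q≤p = contradiction (≤-trans q≤p (p⊆q⇒∣p∣≤∣q∣ (drop-∷-⊆ p⊆q))) (<-irrefl refl)
⊆∧∣≥∣⇒≡ {p = inside  ∷ p} {outside ∷ q} p⊆q _   with () ← p⊆q here

∁-involutive : ∀ {n} (p : Subset n) → ∁ (∁ p) ≡ p
∁-involutive p = trans (sym (map-∘ _ _ p)) (trans (map-cong not-involutive p) (map-id p))

-- Pascal's rule: a subset of `inside ∷ q` either contains the first index or does not, while
-- `outside` leaves no choice.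
card-⊆ : ∀ {n} (q : Subset n) r → (λ p → p ⊆ q × ∣ p ∣ ≡ r) HasCardinality (∣ q ∣ C r)
card-⊆ []            zero    = card-singleton [] λ { [] → mk⇔ (λ _ → refl) (λ _ → (λ ()) , refl) }
card-⊆ []            (suc r) = card-zero λ { [] (_ , ()) }
card-⊆ (outside ∷ q) r       = card-resp consider (card-map (outside ∷_) ∷-injectiveʳ (card-⊆ q r))
  where
  consider : ∀ p → (∃ λ p′ → (p′ ⊆ q × ∣ p′ ∣ ≡ r) × p ≡ outside ∷ p′) ⇔ (p ⊆ outside ∷ q × ∣ p ∣ ≡ r)
  consider (outside ∷ p) = mk⇔ (λ { (_ , (p⊆q , eq) , refl) → s⊆s p⊆q , eq })
                               (λ (p⊆q , eq) → p , (drop-∷-⊆ p⊆q , eq) , refl)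
  consider (inside  ∷ p) = mk⇔ (λ { (_ , _ , ()) }) λ (p⊆q , _) → contradiction (p⊆q here) λ ()
card-⊆ {suc n} (inside ∷ q)  zero    = card-singleton ⊥ λ p → mk⇔ (∣p∣≡0⇒p≡⊥ ∘ proj₂)
  λ { refl → (λ {_} → ⊥⊆) , ∣⊥∣≡0 (suc n) }
card-⊆ {suc n} (inside ∷ q)  (suc r) = card-≡ (nCk+nC[k+1]≡[n+1]C[k+1] ∣ q ∣ r)
  (card-resp consider (card-⊎ (card-map (inside ∷_) ∷-injectiveʳ (card-⊆ q r))
                              (card-map (outside ∷_) ∷-injectiveʳ (card-⊆ q (suc r)))
    λ { _ (_ , _ , refl) (_ , _ , ()) }))
  where
  consider : ∀ p → ((∃ λ p′ → (p′ ⊆ q × ∣ p′ ∣ ≡ r) × p ≡ inside ∷ p′) ⊎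
                    (∃ λ p′ → (p′ ⊆ q × ∣ p′ ∣ ≡ suc r) × p ≡ outside ∷ p′)) ⇔
                   (p ⊆ inside ∷ q × ∣ p ∣ ≡ suc r)
  consider (inside  ∷ p) = mk⇔
    (λ { (inj₁ (_ , (p⊆q , eq) , refl)) → s⊆s p⊆q , cong suc eq ; (inj₂ (_ , _ , ())) })
    (λ (p⊆q , eq) → inj₁ (p , (drop-∷-⊆ p⊆q , suc-injective eq) , refl))
  consider (outside ∷ p) = mk⇔
    (λ { (inj₁ (_ , _ , ())) ; (inj₂ (_ , (p⊆q , eq) , refl)) → out⊆ p⊆q , eq })
    (λ (p⊆q , eq) → inj₂ (p , (drop-∷-⊆ p⊆q , eq) , refl))

-- Complementation turns supersets of `p` into subsets of `∁ p`, and the symmetry of binomial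
-- coefficients restores the stated form.
card-⊇ : ∀ {n} (p : Subset n) {r} → ∣ p ∣ ≤ r → r ≤ n →
         (λ q → p ⊆ q × ∣ q ∣ ≡ r) HasCardinality ((n ∸ ∣ p ∣) C (r ∸ ∣ p ∣))
card-⊇ {n} p {r} p≤r r≤n = card-≡ count
  (card-resp complement (card-map ∁ ∁-injective (card-⊆ (∁ p) (n ∸ r))))
  where
  open ≡-Reasoning

  ∁-injective : ∀ {q q′ : Subset n} → ∁ q ≡ ∁ q′ → q ≡ q′
  ∁-injective {q} {q′} eq = trans (sym (∁-involutive q)) (trans (cong ∁ eq) (∁-involutive q′))

  complement : ∀ q → (∃ λ q′ → (q′ ⊆ ∁ p × ∣ q′ ∣ ≡ n ∸ r) × q ≡ ∁ q′) ⇔ (p ⊆ q × ∣ q ∣ ≡ r)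
  complement q = mk⇔
    (λ { (q′ , (q′⊆∁p , eq) , refl) →
         subst (_⊆ ∁ q′) (∁-involutive p) (p⊆q⇒∁p⊇∁q q′⊆∁p) ,
         trans (∣∁p∣≡n∸∣p∣ q′) (trans (cong (n ∸_) eq) (m∸[m∸n]≡n r≤n)) })
    λ (p⊆q , eq) → ∁ q , (p⊆q⇒∁p⊇∁q p⊆q , trans (∣∁p∣≡n∸∣p∣ q) (cong (n ∸_) eq)) , sym (∁-involutive q)

  count : ∣ ∁ p ∣ C (n ∸ r) ≡ (n ∸ ∣ p ∣) C (r ∸ ∣ p ∣)
  count = begin
    ∣ ∁ p ∣ C (n ∸ r)                                   ≡⟨ cong₂ _C_ (∣∁p∣≡n∸∣p∣ p) n∸r ⟩
    (n ∸ ∣ p ∣) C ((n ∸ ∣ p ∣) ∸ (r ∸ ∣ p ∣))           ≡⟨ nCk≡nC[n∸k] (∸-monoˡ-≤ ∣ p ∣ r≤n) ⟨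
    (n ∸ ∣ p ∣) C (r ∸ ∣ p ∣)                           ∎
    where
    n∸r : n ∸ r ≡ (n ∸ ∣ p ∣) ∸ (r ∸ ∣ p ∣)
    n∸r = trans (cong (n ∸_) (sym (m+[n∸m]≡n p≤r))) (sym (∸-+-assoc n ∣ p ∣ (r ∸ ∣ p ∣)))

card-all : ∀ n r → (λ (p : Subset n) → ∣ p ∣ ≡ r) HasCardinality (n C r)
card-all n r = card-≡ (cong (_C r) (∣⊤∣≡n n))
  (card-resp (λ p → mk⇔ proj₂ λ eq → (λ {_} → ⊆-max p) , eq) (card-⊆ ⊤ r))

-- Signed subsets

-- There is no `-xₙ`, so negative elements use one index fewer than positive ones. The extra
-- `outside` at the end puts both over the same index set, in step with `inject₁`.
pad : ∀ {m} → Subset m → Subset (suc m)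
pad []      = outside ∷ []
pad (s ∷ q) = s ∷ pad q

pad-⊥ : ∀ m → pad (⊥ {m}) ≡ ⊥
pad-⊥ zero    = refl
pad-⊥ (suc m) = cong (outside ∷_) (pad-⊥ m)

∈-pad⁺ : ∀ {m} {q : Subset m} {b} → b ∈ q → inject₁ b ∈ pad q
∈-pad⁺ here        = here
∈-pad⁺ (there b∈q) = there (∈-pad⁺ b∈q)

∈-pad⁻ : ∀ {m} (q : Subset m) {a} → a ∈ pad q → ∃ λ b → b ∈ q × inject₁ b ≡ a
∈-pad⁻ []      (there ())
∈-pad⁻ (s ∷ q) here        = zero , here , refl
∈-pad⁻ (s ∷ q) (there a∈q) = let b , b∈q , eq = ∈-pad⁻ q a∈q in suc b , there b∈q , cong suc eq

-- Signed p q a: the positive elements p and the negative elements q are disjoint, have union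
-- a, and the largest element of a is positive.
data Signed : ∀ {m} → Subset (suc m) → Subset m → Subset (suc m) → Set where
  top   : ∀ {m} → Signed {m} (inside ∷ ⊥) ⊥ (inside ∷ ⊥)
  none  : ∀ {m p q a} → Signed {m} p q a → Signed (outside ∷ p) (outside ∷ q) (outside ∷ a)
  plus  : ∀ {m p q a} → Signed {m} p q a → Signed (inside ∷ p) (outside ∷ q) (inside ∷ a)
  minus : ∀ {m p q a} → Signed {m} p q a → Signed (outside ∷ p) (inside ∷ q) (inside ∷ a)

signed-nonempty : ∀ {m p q a} → Signed {m} p q a → ∣ a ∣ ≢ 0
signed-nonempty (none s) = signed-nonempty s

signed-size : ∀ {m p q a} → Signed {m} p q a → ∣ p ∣ + ∣ q ∣ ≡ ∣ a ∣
signed-size (top {m}) = cong suc (trans (cong (∣ ⊥ {m} ∣ +_) (∣⊥∣≡0 m)) (+-identityʳ _))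
signed-size (none s) = signed-size s
signed-size (plus s) = cong suc (signed-size s)
signed-size (minus s) = trans (+-suc _ _) (cong suc (signed-size s))

signed-union : ∀ {m p q a} → Signed {m} p q a → a ≡ p ∪ pad q
signed-union (top {m}) = trans (sym (∪-identityʳ (inside ∷ ⊥))) (cong ((inside ∷ ⊥) ∪_) (sym (pad-⊥ m)))
signed-union (none s) = cong (outside ∷_) (signed-union s)
signed-union (plus s) = cong (inside ∷_) (signed-union s)
signed-union (minus s) = cong (inside ∷_) (signed-union s)

signed-disjoint : ∀ {m p q a} → Signed {m} p q a → ∀ {b} → inject₁ b ∈ p → b ∉ q
signed-disjoint top      {zero}  _           ()
signed-disjoint top      {suc b} _           (there b∈⊥) = ∉⊥ b∈⊥
signed-disjoint (none s) {suc b} (there b∈p) (there b∈q) = signed-disjoint s b∈p b∈q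
signed-disjoint (plus s) {suc b} (there b∈p) (there b∈q) = signed-disjoint s b∈p b∈q
signed-disjoint (minus s) {suc b} (there b∈p) (there b∈q) = signed-disjoint s b∈p b∈q

signed-max : ∀ {m p q a} → Signed {m} p q a → ∃ λ i → i ∈ p × (∀ {j} → j ∈ a → j Fin.≤ i)
signed-max top      = zero , here , λ { here → z≤n ; (there j∈⊥) → contradiction j∈⊥ ∉⊥ }
signed-max (none s) = let i , i∈p , max = signed-max s in
  suc i , there i∈p , λ { (there j∈a) → s≤s (max j∈a) }
signed-max (plus s) = let i , i∈p , max = signed-max s in
  suc i , there i∈p , λ { here → z≤n ; (there j∈a) → s≤s (max j∈a) }
signed-max (minus s) = let i , i∈p , max = signed-max s in
  suc i , there i∈p , λ { here → z≤n ; (there j∈a) → s≤s (max j∈a) }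

-- The position `i` of the maximum drives the recursion: before it, disjointness leaves three
-- possibilities at each index, one per constructor; at it, maximality empties both tails and `top`
-- applies.
signed : ∀ {m} (p : Subset (suc m)) (q : Subset m) → (∀ {b} → inject₁ b ∈ p → b ∉ q) →
         ∀ i → i ∈ p → (∀ {j} → j ∈ p ∪ pad q → j Fin.≤ i) → Signed p q (p ∪ pad q)
signed {m} (inside ∷ p) q disjoint zero here max = only-top p≡⊥ q≡⊥
  where
  only-top : p ≡ ⊥ → q ≡ ⊥ → Signed (inside ∷ p) q ((inside ∷ p) ∪ pad q)
  only-top refl refl = subst (Signed _ _) (signed-union top) top

  p≡⊥ : p ≡ ⊥
  p≡⊥ = Empty-unique λ (j , j∈p) → contradiction (max (p⊆p∪q (pad q) (there j∈p))) λ ()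

  q≡⊥ : q ≡ ⊥
  q≡⊥ = Empty-unique λ
    { (zero  , 0∈q) → disjoint here 0∈q
    ; (suc b , b∈q) → contradiction (max (q⊆p∪q (inside ∷ p) (pad q) (∈-pad⁺ b∈q))) λ () }
signed {zero}  (s ∷ [])   [] _ (suc ())
signed {suc m} (s ∷ p) (t ∷ q) disjoint (suc i) (there i∈p) max = extend s t (disjoint {zero})
  (signed p q (λ b∈p b∈q → disjoint (there b∈p) (there b∈q)) i i∈p
    λ j∈ → ≤-pred (max (there j∈)))
  where
  extend : ∀ s t → (zero ∈ s ∷ p → zero ∉ t ∷ q) → Signed p q (p ∪ pad q) →
           Signed (s ∷ p) (t ∷ q) ((s ∷ p) ∪ pad (t ∷ q))
  extend inside  inside  d _ = contradiction here (d here)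
  extend inside  outside _   = plus
  extend outside inside  _   = minus
  extend outside outside _   = none

SignedPair : ∀ {m} → Subset (suc m) → Pred (Subset (suc m) × Subset m) 0ℓ
SignedPair a (p , q) = Signed p q a

cons : ∀ {m} → Side → Side → Subset (suc m) × Subset m → Subset (2 + m) × Subset (suc m)
cons s t (p , q) = s ∷ p , t ∷ q

cons-injective : ∀ {m s t} {pq pq′ : Subset (suc m) × Subset m} → cons s t pq ≡ cons s t pq′ → pq ≡ pq′
cons-injective refl = refl

-- Each element of `a` below the maximum is free to be positive or negative, which doubles the
-- count; the maximum must be positive, hence the exponent is one less than the size. An empty tail
-- leaves only `top`, a nonempty tail excludes it.
card-signed : ∀ {m} (a : Subset (suc m)) r → ∣ a ∣ ≡ suc r → SignedPair a HasCardinality (2 ^ r)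
card-signed {zero} (inside ∷ []) zero eq = card-singleton (inside ∷ [] , [])
  λ _ → mk⇔ (λ { top → refl }) λ { refl → top }
card-signed {suc m} (outside ∷ a) r eq =
  card-resp (λ _ → mk⇔ (λ { (_ , s , refl) → none s }) λ { (none s) → _ , s , refl })
    (card-map (cons outside outside) cons-injective (card-signed a r eq))
card-signed {suc m} (inside ∷ a) zero eq with refl ← ∣p∣≡0⇒p≡⊥ {p = a} (suc-injective eq) =
  card-singleton (inside ∷ ⊥ , ⊥) λ _ → mk⇔ only-top λ { refl → top }
  where
  only-top : ∀ {pq} → SignedPair (inside ∷ ⊥) pq → pq ≡ (inside ∷ ⊥ , ⊥)
  only-top top     = refl
  only-top (plus s) = contradiction (∣⊥∣≡0 (suc m)) (signed-nonempty s)
  only-top (minus s) = contradiction (∣⊥∣≡0 (suc m)) (signed-nonempty s)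
card-signed {suc m} (inside ∷ a) (suc r) eq =
  card-≡ (cong (2 ^ r +_) (sym (+-identityʳ _)))
    (card-resp (λ _ → mk⇔ (λ { (inj₁ (_ , s , refl)) → plus s ; (inj₂ (_ , s , refl)) → minus s })
                          (split (suc-injective eq)))
      (card-⊎ (card-map (cons inside outside) cons-injective rec)
              (card-map (cons outside inside) cons-injective rec)
              λ { _ (_ , _ , refl) (_ , _ , ()) }))
  where
  rec = card-signed a r (suc-injective eq)

  split : ∀ {a pq} → ∣ a ∣ ≡ suc r → SignedPair (inside ∷ a) pq →
          (∃ λ pq′ → SignedPair a pq′ × pq ≡ cons inside outside pq′) ⊎
          (∃ λ pq′ → SignedPair a pq′ × pq ≡ cons outside inside pq′)
  split eq top     = contradiction (trans (sym eq) (∣⊥∣≡0 (suc m))) λ ()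
  split _  (plus s) = inj₁ (_ , s , refl)
  split _  (minus s) = inj₂ (_ , s , refl)

-- Binomial sums

sum-applyUpTo-cong : ∀ {f g : ℕ → ℕ} → f ≗ g → ∀ n → sum (applyUpTo f n) ≡ sum (applyUpTo g n)
sum-applyUpTo-cong f≗g zero    = refl
sum-applyUpTo-cong f≗g (suc n) = cong₂ _+_ (f≗g 0) (sum-applyUpTo-cong (f≗g ∘ suc) n)

sum-applyUpTo-∷ʳ : ∀ (f : ℕ → ℕ) n → sum (applyUpTo f (suc n)) ≡ sum (applyUpTo f n) + f n
sum-applyUpTo-∷ʳ f n = begin
  sum (applyUpTo f (suc n))         ≡⟨ cong sum (applyUpTo-∷ʳ f n) ⟨
  sum (applyUpTo f n ∷ʳ f n)        ≡⟨ sum-++ (applyUpTo f n) (f n ∷ []) ⟩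
  sum (applyUpTo f n) + (f n + 0)   ≡⟨ cong (sum (applyUpTo f n) +_) (+-identityʳ (f n)) ⟩
  sum (applyUpTo f n) + f n         ∎
  where open ≡-Reasoning

sum-applyUpTo-linear : ∀ c (f g : ℕ → ℕ) n →
  sum (applyUpTo (λ s → c * f s + g s) n) ≡ c * sum (applyUpTo f n) + sum (applyUpTo g n)
sum-applyUpTo-linear c f g zero    = sym (trans (+-identityʳ (c * 0)) (*-zeroʳ c))
sum-applyUpTo-linear c f g (suc n) = trans
  (cong (c * f 0 + g 0 +_) (sum-applyUpTo-linear c (f ∘ suc) (g ∘ suc) n))
  (solve 5 (λ c x y a b → (c :* x :+ y) :+ (c :* a :+ b) := c :* (x :+ a) :+ (y :+ b)) refl
     c (f 0) (g 0) (sum (applyUpTo (f ∘ suc) n)) (sum (applyUpTo (g ∘ suc) n)))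
  where open +-*-Solver

sum-applyUpTo-* : ∀ c (f : ℕ → ℕ) n → sum (applyUpTo (λ s → c * f s) n) ≡ c * sum (applyUpTo f n)
sum-applyUpTo-* c f zero    = sym (*-zeroʳ c)
sum-applyUpTo-* c f (suc n) = trans (cong (c * f 0 +_) (sum-applyUpTo-* c (f ∘ suc) n))
  (sym (*-distribˡ-+ c (f 0) (sum (applyUpTo (f ∘ suc) n))))

-- The binomial theorem for `(1 + 2) ^ k`, by Pascal's rule. With `G` the sum for `k`, one half of
-- the rule contributes `2 * G`, the other contributes `G` without its term `s = 0`; the isolated
-- summand `1` is that missing term.
sum-2^s*kCs : ∀ k → sum (applyUpTo (λ s → 2 ^ s * (k C s)) (suc k)) ≡ 3 ^ k
sum-2^s*kCs zero    = refl
sum-2^s*kCs (suc k) = begin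
  1 + sum (applyUpTo (λ s → g (suc k) (suc s)) (suc k))
    ≡⟨ cong suc (sum-applyUpTo-cong pascal (suc k)) ⟩
  1 + sum (applyUpTo (λ s → 2 * g k s + g k (suc s)) (suc k))
    ≡⟨ cong suc (sum-applyUpTo-linear 2 (g k) (g k ∘ suc) (suc k)) ⟩
  1 + (2 * G + sum (applyUpTo (g k ∘ suc) (suc k)))
    ≡⟨ +-suc (2 * G) _ ⟨
  2 * G + sum (applyUpTo (g k) (2 + k))
    ≡⟨ cong (2 * G +_) (sum-applyUpTo-∷ʳ (g k) (suc k)) ⟩
  2 * G + (G + g k (suc k))
    -- The shifted sum runs one term too far, to `s = k + 1`, where the binomial coefficient is
    -- zero.
    ≡⟨ cong (λ c → 2 * G + (G + 2 ^ suc k * c)) (k>n⇒nCk≡0 (n<1+n k)) ⟩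
  2 * G + (G + 2 ^ suc k * 0)
    ≡⟨ cong (λ c → 2 * G + (G + c)) (*-zeroʳ (2 ^ suc k)) ⟩
  2 * G + (G + 0)
    ≡⟨ solve 1 (λ G → con 2 :* G :+ (G :+ con 0) := con 3 :* G) refl G ⟩
  3 * G
    ≡⟨ cong (3 *_) (sum-2^s*kCs k) ⟩
  3 ^ suc k ∎
  where
  open ≡-Reasoning
  open +-*-Solver
  g : ℕ → ℕ → ℕ
  g k s = 2 ^ s * (k C s)
  G = sum (applyUpTo (g k) (suc k))

  pascal : ∀ s → g (suc k) (suc s) ≡ 2 * g k s + g k (suc s)
  pascal s = trans (cong (2 ^ suc s *_) (sym (nCk+nC[k+1]≡[n+1]C[k+1] k s)))
    (solve 3 (λ p a b → (con 2 :* p) :* (a :+ b) := con 2 :* (p :* a) :+ (con 2 :* p) :* b) refl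
       (2 ^ s) (k C s) (k C suc s))

-- The number of Signed p q a with a ⊆ b, for a fixed b with ∣ b ∣ ≡ k.
signedCount : ℕ → ℕ
signedCount k = sum (map (λ s → 2 ^ (s ∸ 1) * (k C s)) (range 1 k))

-- Doubling turns the weights `2 ^ (s ∸ 1)` into `2 ^ s`, and the summand `1` is the term `s = 0` of
-- the full binomial sum.
1+2*signedCount : ∀ k → 1 + 2 * signedCount k ≡ 3 ^ k
1+2*signedCount k = begin
  1 + 2 * signedCount k
    ≡⟨ cong (λ l → 1 + 2 * sum l) (map-applyUpTo suc (λ s → 2 ^ (s ∸ 1) * (k C s)) k) ⟩
  1 + 2 * sum (applyUpTo (λ s → 2 ^ s * (k C suc s)) k)
    ≡⟨ cong suc (sum-applyUpTo-* 2 (λ s → 2 ^ s * (k C suc s)) k) ⟨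
  1 + sum (applyUpTo (λ s → 2 * (2 ^ s * (k C suc s))) k)
    ≡⟨ cong suc (sum-applyUpTo-cong (λ s → *-assoc 2 (2 ^ s) (k C suc s)) k) ⟨
  sum (applyUpTo (λ s → 2 ^ s * (k C s)) (suc k))
    ≡⟨ sum-2^s*kCs k ⟩
  3 ^ k ∎
  where open ≡-Reasoning

-- The signs split into `k + 1` fixed factors of 2 and the `t ∸ 1` factors already present in
-- `signedCount`.
signedCount-shift : ∀ k m →
  sum (map (λ t → 2 ^ (suc k + t ∸ 1) * (m C t)) (range 1 m)) ≡ 2 ^ suc k * signedCount m
signedCount-shift k m = begin
  sum (map (λ t → 2 ^ (k + t) * (m C t)) (range 1 m))
    ≡⟨ cong sum (map-applyUpTo suc (λ t → 2 ^ (k + t) * (m C t)) m) ⟩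
  sum (applyUpTo (λ t → 2 ^ (k + suc t) * (m C suc t)) m)
    ≡⟨ sum-applyUpTo-cong (λ t → trans (cong (_* (m C suc t)) (pow t)) (*-assoc (2 ^ suc k) (2 ^ t) (m C suc t))) m ⟩
  sum (applyUpTo (λ t → 2 ^ suc k * (2 ^ t * (m C suc t))) m)
    ≡⟨ sum-applyUpTo-* (2 ^ suc k) (λ t → 2 ^ t * (m C suc t)) m ⟩
  2 ^ suc k * sum (applyUpTo (λ t → 2 ^ t * (m C suc t)) m)
    ≡⟨ cong (λ l → 2 ^ suc k * sum l) (map-applyUpTo suc (λ s → 2 ^ (s ∸ 1) * (m C s)) m) ⟨
  2 ^ suc k * signedCount m ∎
  where
  open ≡-Reasoning
  pow : ∀ t → 2 ^ (k + suc t) ≡ 2 ^ suc k * 2 ^ t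
  pow t = trans (cong (2 ^_) (+-suc k t)) (^-distribˡ-+-* 2 (suc k) t)

d-V₁-closed : ∀ n k → 1 ≤ k → d-V₁ n k ≡ (3 ^ k ∸ 3) / 2 + 2 ^ (k ∸ 1) * (3 ^ (n ∸ k) ∸ 1)
d-V₁-closed n (suc k) _ = cong₂ _+_ below above
  where
  open ≡-Reasoning
  T = signedCount (suc k)
  U = signedCount (n ∸ suc k)

  below : T ∸ 1 ≡ (3 ^ suc k ∸ 3) / 2
  below = begin
    T ∸ 1                       ≡⟨ m*n/n≡m (T ∸ 1) 2 ⟨
    (T ∸ 1) * 2 / 2             ≡⟨ cong (_/ 2) (*-distribʳ-∸ 2 T 1) ⟩
    (T * 2 ∸ 2) / 2             ≡⟨ cong (λ z → (z ∸ 2) / 2) (*-comm T 2) ⟩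
    -- `2 * T ∸ 2` and `1 + 2 * T ∸ 3` agree by computation, which exposes `1 + 2 * T` as a power of
    -- 3.
    (1 + 2 * T ∸ 3) / 2         ≡⟨ cong (λ z → (z ∸ 3) / 2) (1+2*signedCount (suc k)) ⟩
    (3 ^ suc k ∸ 3) / 2         ∎

  above : sum (map (λ t → 2 ^ (suc k + t ∸ 1) * ((n ∸ suc k) C t)) (range 1 (n ∸ suc k)))
          ≡ 2 ^ k * (3 ^ (n ∸ suc k) ∸ 1)
  above = begin
    _                             ≡⟨ signedCount-shift k (n ∸ suc k) ⟩
    2 * 2 ^ k * U                 ≡⟨ cong (_* U) (*-comm 2 (2 ^ k)) ⟩
    2 ^ k * 2 * U                 ≡⟨ *-assoc (2 ^ k) 2 U ⟩
    2 ^ k * (1 + 2 * U ∸ 1)       ≡⟨ cong (λ z → 2 ^ k * (z ∸ 1)) (1+2*signedCount (n ∸ suc k)) ⟩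
    2 ^ k * (3 ^ (n ∸ suc k) ∸ 1) ∎

-- Real numbers

infix 4 _≐_

-- Stronger than `_≃_`: the sequences agree term by term from some index on. A positive real and its
-- absolute value are related in this way, and both `_≃_` and `_<ℝ_` can then be transported by
-- `subst`, with no estimates.
record _≐_ (u v : ℝ) : Set where
  constructor eventually
  field
    from-index : ℕ
    equal      : ∀ n → from-index ≤ n → seq u n ≡ seq v n

≐-sym : ∀ {u v} → u ≐ v → v ≐ u
≐-sym (eventually N eq) = eventually N λ n N≤n → sym (eq n N≤n)

≃-refl : ∀ u → u ≃ u
≃-refl u ε 0<ε = 0 , λ n _ → subst (λ p → ℚ.∣ p ∣ ℚ.< ε) (sym (ℚ.+-inverseʳ (seq u n))) 0<ε

≃-≐-trans : ∀ {u v w} → u ≃ v → v ≐ w → u ≃ w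
≃-≐-trans {u} u≃v (eventually N eq) ε 0<ε = let M , close = u≃v ε 0<ε in
  M ⊔ N , λ n M⊔N≤n → subst (λ q → ℚ.∣ seq u n ℚ.- q ∣ ℚ.< ε) (eq n (m⊔n≤o⇒n≤o M N M⊔N≤n))
    (close n (m⊔n≤o⇒m≤o M N M⊔N≤n))

≐-≃-trans : ∀ {u v w} → u ≐ v → v ≃ w → u ≃ w
≐-≃-trans {w = w} (eventually N eq) v≃w ε 0<ε = let M , close = v≃w ε 0<ε in
  M ⊔ N , λ n M⊔N≤n → subst (λ p → ℚ.∣ p ℚ.- seq w n ∣ ℚ.< ε) (sym (eq n (m⊔n≤o⇒n≤o M N M⊔N≤n)))
    (close n (m⊔n≤o⇒m≤o M N M⊔N≤n))

≐⇒≃ : ∀ {u v} → u ≐ v → u ≃ v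
≐⇒≃ {u} {v} u≐v = ≐-≃-trans {u} {v} {v} u≐v (≃-refl v)

<ℝ-resp-≐ : ∀ {u u′ v v′} → u ≐ u′ → v ≐ v′ → u <ℝ v → u′ <ℝ v′
<ℝ-resp-≐ (eventually M eq) (eventually N eq′) (ε , 0<ε , L , lt) = ε , 0<ε , L ⊔ (M ⊔ N) , λ n le →
  let L≤n = m⊔n≤o⇒m≤o L (M ⊔ N) le ; le′ = m⊔n≤o⇒n≤o L (M ⊔ N) le in
  subst₂ (λ p q → p ℚ.+ ε ℚ.< q)
    (eq n (m⊔n≤o⇒m≤o M N le′)) (eq′ n (m⊔n≤o⇒n≤o M N le′)) (lt n L≤n)

0<⇒p<p+ε : ∀ p {ε} → 0ℚ ℚ.< ε → p ℚ.< p ℚ.+ ε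
0<⇒p<p+ε p 0<ε = subst (ℚ._< p ℚ.+ _) (ℚ.+-identityʳ p) (ℚ.+-monoʳ-< p 0<ε)

<ℝ-eventually : ∀ {u v} → u <ℝ v → ∃ λ N → ∀ n → N ≤ n → seq u n ℚ.< seq v n
<ℝ-eventually {u} (ε , 0<ε , N , lt) = N , λ n N≤n → ℚ.<-trans (0<⇒p<p+ε (seq u n) 0<ε) (lt n N≤n)

<ℝ-asym : ∀ {u v} → u <ℝ v → ¬ (v <ℝ u)
<ℝ-asym {u} {v} u<v v<u =
  let M , lt = <ℝ-eventually {u} {v} u<v ; N , gt = <ℝ-eventually {v} {u} v<u in
  ℚ.<-asym (lt (M ⊔ N) (m≤m⊔n M N)) (gt (M ⊔ N) (m≤n⊔m M N))

p≤∣p∣ : ∀ p → p ℚ.≤ ℚ.∣ p ∣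
p≤∣p∣ p with ℚ.≤-total 0ℚ p
... | inj₁ 0≤p = ℚ.≤-reflexive (sym (ℚ.0≤p⇒∣p∣≡p 0≤p))
... | inj₂ p≤0 = ℚ.≤-trans p≤0 (ℚ.0≤∣p∣ p)

∣p-q∣≡∣q-p∣ : ∀ p q → ℚ.∣ p ℚ.- q ∣ ≡ ℚ.∣ q ℚ.- p ∣
∣p-q∣≡∣q-p∣ p q = trans (sym (ℚ.∣-p∣≡∣p∣ (p ℚ.- q)))
  (cong ℚ.∣_∣ (trans (⁻¹-anti-homo-∙ p (ℚ.- q)) (cong (ℚ._- p) (⁻¹-involutive q))))

≃-sym : ∀ {u v} → u ≃ v → v ≃ u
≃-sym {u} {v} u≃v ε 0<ε = let N , close = u≃v ε 0<ε in
  N , λ n N≤n → subst (ℚ._< ε) (∣p-q∣≡∣q-p∣ (seq u n) (seq v n)) (close n N≤n)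

-- The gap `ε` of the strict inequality serves as the tolerance at which the equality is tested.
<ℝ⇒≄ : ∀ {u v} → u <ℝ v → ¬ (v ≃ u)
<ℝ⇒≄ {u} {v} (ε , 0<ε , M , lt) v≃u =
  let N , close = v≃u ε 0<ε
      n = M ⊔ N
      p = seq u n
      q = seq v n
      q-p<ε = ℚ.≤-<-trans (p≤∣p∣ (q ℚ.- p)) (close n (m≤n⊔m M N))
      q≡q-p+p = sym (trans (ℚ.+-assoc q (ℚ.- p) p)
                      (trans (cong (q ℚ.+_) (ℚ.+-inverseˡ p)) (ℚ.+-identityʳ q)))
      q<p+ε = subst₂ ℚ._<_ (sym q≡q-p+p) (ℚ.+-comm ε p) (ℚ.+-monoˡ-< p q-p<ε)
  in ℚ.<-asym q<p+ε (lt n (m≤m⊔n M N))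

0<⇒abs≐ : ∀ {u} → 0ℝ <ℝ u → abs u ≐ u
0<⇒abs≐ {u} 0<u = let N , pos = <ℝ-eventually {0ℝ} {u} 0<u in eventually N λ n N≤n → ℚ.0≤p⇒∣p∣≡p (ℚ.<⇒≤ (pos n N≤n))

0<⇒abs-neg≐ : ∀ {u} → 0ℝ <ℝ u → abs (-ℝ u) ≐ u
0<⇒abs-neg≐ {u} 0<u = let eventually N eq = 0<⇒abs≐ {u} 0<u in eventually N λ n N≤n → trans (ℚ.∣-p∣≡∣p∣ (seq u n)) (eq n N≤n)

0<⇒neg≮ : ∀ {u} → 0ℝ <ℝ u → ¬ (0ℝ <ℝ -ℝ u)
0<⇒neg≮ {u} 0<u 0<-u =
  let M , pos = <ℝ-eventually {0ℝ} {u} 0<u ; N , pos′ = <ℝ-eventually {0ℝ} { -ℝ u} 0<-u ; n = M ⊔ N in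
  ℚ.<-asym (ℚ.neg-antimono-< (pos n (m≤m⊔n M N))) (pos′ n (m≤n⊔m M N))

-- The gap `ε` separating `v` from zero also separates it from `-ℝ u`, whose terms are eventually
-- negative.
neg<pos : ∀ {u v} → 0ℝ <ℝ u → 0ℝ <ℝ v → -ℝ u <ℝ v
neg<pos {u} 0<u (ε , 0<ε , M , lt) = let N , pos = <ℝ-eventually {0ℝ} {u} 0<u in
  ε , 0<ε , M ⊔ N , λ n M⊔N≤n →
    ℚ.<-trans (ℚ.+-monoˡ-< ε (ℚ.neg-antimono-< (pos n (m⊔n≤o⇒n≤o M N M⊔N≤n))))
              (lt n (m⊔n≤o⇒m≤o M N M⊔N≤n))

-- Subsets of 𝓑 as signed subsets


∈-↑ˡ⁺ : ∀ {m n} {p : Subset m} {q : Subset n} {a} → a ∈ p → a ↑ˡ n ∈ p ++ q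
∈-↑ˡ⁺ here        = here
∈-↑ˡ⁺ (there a∈p) = there (∈-↑ˡ⁺ a∈p)

∈-↑ˡ⁻ : ∀ {m n} (p : Subset m) {q : Subset n} {a} → a ↑ˡ n ∈ p ++ q → a ∈ p
∈-↑ˡ⁻ (s ∷ p) {a = zero}  here       = here
∈-↑ˡ⁻ (s ∷ p) {a = suc a} (there a∈) = there (∈-↑ˡ⁻ p a∈)

∈-↑ʳ⁺ : ∀ {m n} (p : Subset m) {q : Subset n} {b} → b ∈ q → m ↑ʳ b ∈ p ++ q
∈-↑ʳ⁺ []      b∈q = b∈q
∈-↑ʳ⁺ (s ∷ p) b∈q = there (∈-↑ʳ⁺ p b∈q)

∈-↑ʳ⁻ : ∀ {m n} (p : Subset m) {q : Subset n} {b} → m ↑ʳ b ∈ p ++ q → b ∈ q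
∈-↑ʳ⁻ []      b∈         = b∈
∈-↑ʳ⁻ (s ∷ p) (there b∈) = ∈-↑ʳ⁻ p b∈

∣p++q∣ : ∀ {m n} (p : Subset m) (q : Subset n) → ∣ p ++ q ∣ ≡ ∣ p ∣ + ∣ q ∣
∣p++q∣ []            q = refl
∣p++q∣ (outside ∷ p) q = ∣p++q∣ p q
∣p++q∣ (inside ∷ p)  q = cong suc (∣p++q∣ p q)

data Split {m n} : Fin (m + n) → Set where
  left  : ∀ a → Split (a ↑ˡ n)
  right : ∀ b → Split (m ↑ʳ b)

split : ∀ m {n} (i : Fin (m + n)) → Split i
split m {n} i with splitAt m i | join-splitAt m n i
... | inj₁ a | refl = left a
... | inj₂ b | refl = right b

module Components (m : ℕ) where

  -- For `n = suc m` the index set `Fin (n + (n ∸ 1))` computes to `Fin (suc m + m)`: the first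
  -- block carries `x₁, …, xₙ`, the second `-x₁, …, -xₙ₋₁`.
  pos : Subset (suc m + m) → Subset (suc m)
  pos = Vec.take (suc m)

  neg : Subset (suc m + m) → Subset m
  neg = Vec.drop (suc m)

  -- The counterpart of `S †` on indices.
  supp : Subset (suc m + m) → Subset (suc m)
  supp S = pos S ∪ pad (neg S)

  pos++neg : ∀ S → pos S ++ neg S ≡ S
  pos++neg = take++drop≡id (suc m)

  pos-++ : ∀ p q → pos (p ++ q) ≡ p
  pos-++ p q = ++-injectiveˡ (pos (p ++ q)) p (pos++neg (p ++ q))

  neg-++ : ∀ p q → neg (p ++ q) ≡ q
  neg-++ p q = ++-injectiveʳ (pos (p ++ q)) p (pos++neg (p ++ q))

  ∣pos∣+∣neg∣ : ∀ S → ∣ S ∣ ≡ ∣ pos S ∣ + ∣ neg S ∣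
  ∣pos∣+∣neg∣ S = trans (cong ∣_∣ (sym (pos++neg S))) (∣p++q∣ (pos S) (neg S))

  ∈-pos⁺ : ∀ {S a} → a ↑ˡ m ∈ S → a ∈ pos S
  ∈-pos⁺ {S} a∈S = ∈-↑ˡ⁻ (pos S) (subst (_ ∈_) (sym (pos++neg S)) a∈S)

  ∈-pos⁻ : ∀ {S a} → a ∈ pos S → a ↑ˡ m ∈ S
  ∈-pos⁻ {S} a∈ = subst (_ ∈_) (pos++neg S) (∈-↑ˡ⁺ a∈)

  ∈-neg⁺ : ∀ {S b} → suc m ↑ʳ b ∈ S → b ∈ neg S
  ∈-neg⁺ {S} b∈S = ∈-↑ʳ⁻ (pos S) (subst (_ ∈_) (sym (pos++neg S)) b∈S)

  ∈-neg⁻ : ∀ {S b} → b ∈ neg S → suc m ↑ʳ b ∈ S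
  ∈-neg⁻ {S} b∈ = subst (_ ∈_) (pos++neg S) (∈-↑ʳ⁺ (pos S) b∈)

  index : Fin (suc m + m) → Fin (suc m)
  index i = [ id , inject₁ ]′ (splitAt (suc m) i)

  index-↑ˡ : ∀ a → index (a ↑ˡ m) ≡ a
  index-↑ˡ a = cong [ id , inject₁ ]′ (splitAt-↑ˡ (suc m) a m)

  index-↑ʳ : ∀ b → index (suc m ↑ʳ b) ≡ inject₁ b
  index-↑ʳ b = cong [ id , inject₁ ]′ (splitAt-↑ʳ (suc m) m b)

  ∈-supp⁺ : ∀ {S i} → i ∈ S → index i ∈ supp S
  ∈-supp⁺ {S} {i} i∈S with split (suc m) i
  ... | left a  rewrite index-↑ˡ a = p⊆p∪q (pad (neg S)) (∈-pos⁺ i∈S)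
  ... | right b rewrite index-↑ʳ b = q⊆p∪q (pos S) (pad (neg S)) (∈-pad⁺ (∈-neg⁺ i∈S))

  ∈-supp⁻ : ∀ {S a} → a ∈ supp S → ∃ λ i → i ∈ S × index i ≡ a
  ∈-supp⁻ {S} {a} a∈ with x∈p∪q⁻ (pos S) (pad (neg S)) a∈
  ... | inj₁ a∈pos = a ↑ˡ m , ∈-pos⁻ a∈pos , index-↑ˡ a
  ... | inj₂ a∈neg = let b , b∈neg , eq = ∈-pad⁻ (neg S) a∈neg in
    suc m ↑ʳ b , ∈-neg⁻ b∈neg , trans (index-↑ʳ b) eq

  IsSigned : Pred (Subset (suc m + m)) 0ℓ
  IsSigned S = Signed (pos S) (neg S) (supp S)

  signed-∣supp∣ : ∀ {S} → IsSigned S → ∣ S ∣ ≡ ∣ supp S ∣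
  signed-∣supp∣ {S} s = trans (∣pos∣+∣neg∣ S) (signed-size s)

  -- The third argument of `Signed` is forced to be the union of the other two, so gluing a pair
  -- signed for `a` gives a subset with support exactly `a`.
  card-supp≡ : ∀ a r → ∣ a ∣ ≡ suc r → (λ S → IsSigned S × supp S ≡ a) HasCardinality (2 ^ r)
  card-supp≡ a r eq = card-resp consider
    (card-map (λ (p , q) → p ++ q) ++-inj (card-signed a r eq))
    where
    ++-inj : ∀ {pq pq′ : Subset (suc m) × Subset m} →
             proj₁ pq ++ proj₂ pq ≡ proj₁ pq′ ++ proj₂ pq′ → pq ≡ pq′
    ++-inj {p , q} {p′ , q′} eq = cong₂ _,_ (++-injectiveˡ p p′ eq) (++-injectiveʳ p p′ eq)

    consider : ∀ S → (∃ λ pq → SignedPair a pq × S ≡ proj₁ pq ++ proj₂ pq) ⇔ (IsSigned S × supp S ≡ a)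
    consider S = mk⇔ split-at λ { (s , refl) → (pos S , neg S) , s , sym (pos++neg S) }
      where
      split-at : (∃ λ pq → SignedPair a pq × S ≡ proj₁ pq ++ proj₂ pq) → IsSigned S × supp S ≡ a
      split-at ((p , q) , s , refl) rewrite pos-++ p q | neg-++ p q | sym (signed-union s) = s , refl

  -- The common source of the powers of 2: any family of supports of fixed size `r` is counted with
  -- `2 ^ (r ∸ 1)` sign patterns over each member.
  card-IsSigned : ∀ {Q : Pred (Subset (suc m)) 0ℓ} {c r} → 1 ≤ r → Q HasCardinality c →
                  (∀ {a} → Q a → ∣ a ∣ ≡ r) →
                  (λ S → IsSigned S × Q (supp S)) HasCardinality (2 ^ (r ∸ 1) * c)
  card-IsSigned {c = c} {suc r} _ Q-card size = card-≡ (*-comm c (2 ^ r))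
    (card-fibration supp Q-card λ q → card-supp≡ _ r (size q))

-- The geometry of 𝓑

module _ {m : ℕ} (x : Vector ℝ (suc m)) where

  𝓑-↑ˡ : ∀ a → 𝓑 x (a ↑ˡ m) ≡ x a
  𝓑-↑ˡ a = cong [ x , _ ]′ (splitAt-↑ˡ (suc m) a m)

  𝓑-↑ʳ : ∀ b → 𝓑 x (suc m ↑ʳ b) ≡ -ℝ x (inject₁ b)
  𝓑-↑ʳ b = trans (cong [ x , _ ]′ (splitAt-↑ʳ (suc m) m b)) (cong (λ i → -ℝ x i)
    (toℕ-injective (trans (toℕ-inject≤ b (m∸n≤m (suc m) 1)) (sym (toℕ-inject₁ b)))))

module Comparison {m : ℕ} (x : Vector ℝ (suc m)) (0<x : ∀ i → 0ℝ <ℝ x i)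
         (x-mono : ∀ {i j} → i Fin.< j → x i <ℝ x j) where

  open Components m

  x-injective : ∀ {i j} → x i ≃ x j → i ≡ j
  x-injective {i} {j} xi≃xj with Fin.<-cmp i j
  ... | tri< i<j _ _ = contradiction (≃-sym {x i} {x j} xi≃xj) (<ℝ⇒≄ {x i} {x j} (x-mono i<j))
  ... | tri≈ _ i≡j _ = i≡j
  ... | tri> _ _ j<i = contradiction xi≃xj (<ℝ⇒≄ {x j} {x i} (x-mono j<i))

  abs-𝓑 : ∀ i → abs (𝓑 x i) ≐ x (index i)
  abs-𝓑 i with split (suc m) i
  ... | left a  rewrite 𝓑-↑ˡ x a | index-↑ˡ a = 0<⇒abs≐ {x a} (0<x a)
  ... | right b rewrite 𝓑-↑ʳ x b | index-↑ʳ b = 0<⇒abs-neg≐ {x (inject₁ b)} (0<x (inject₁ b))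

  abs-𝓑-≃ : ∀ i j → abs (𝓑 x i) ≃ abs (𝓑 x j) ⇔ index i ≡ index j
  abs-𝓑-≃ i j = mk⇔
    (λ i≃j → x-injective (≐-≃-trans {w = x (index j)} (≐-sym (abs-𝓑 i))
               (≃-≐-trans {abs (𝓑 x i)} i≃j (abs-𝓑 j))))
    λ eq → ≃-≐-trans {abs (𝓑 x i)} (≐⇒≃ (abs-𝓑 i))
             (subst (λ a → x a ≐ abs (𝓑 x j)) (sym eq) (≐-sym (abs-𝓑 j)))

  x-≤ : ∀ {a b} → a Fin.≤ b → x a ≤ℝ x b
  x-≤ {a} {b} a≤b xb<xa with Fin.<-cmp a b
  ... | tri< a<b _ _  = <ℝ-asym {x b} {x a} xb<xa (x-mono a<b)
  ... | tri≈ _ refl _ = <ℝ-asym {x a} {x a} xb<xa xb<xa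
  ... | tri> _ _ b<a  = <⇒≱ b<a a≤b

  -- `_≤ℝ_` is a negated strict inequality, so both directions go by contraposition; decidability of
  -- the order on indices yields the positive conclusion of the first.
  abs-𝓑-≤ : ∀ i j → abs (𝓑 x i) ≤ℝ abs (𝓑 x j) ⇔ index i Fin.≤ index j
  abs-𝓑-≤ i j = mk⇔
    (λ i≤j → ≮⇒≥ λ j<i → i≤j (<ℝ-resp-≐ (≐-sym (abs-𝓑 j)) (≐-sym (abs-𝓑 i)) (x-mono j<i)))
    λ i≤j j<i → x-≤ i≤j (<ℝ-resp-≐ (abs-𝓑 j) (abs-𝓑 i) j<i)

  -- Disjointness of `pos S` and `neg S` is `distinct-abs` at a pair of opposite elements, and
  -- `max-positive` gives the index that `signed` recurses on. Conversely `signed-max` supplies the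
  -- positive maximum and with it nonemptiness.
  φ⇔IsSigned : ∀ S → φ x S ⇔ IsSigned S
  φ⇔IsSigned S = mk⇔ φ⇒ ⇒φ
    where
    φ⇒ : φ x S → IsSigned S
    φ⇒ φS with φ.max-positive φS
    ... | i , i∈S , max , 0<i with split (suc m) i
    ... | right b rewrite 𝓑-↑ʳ x b = contradiction 0<i (0<⇒neg≮ {x (inject₁ b)} (0<x (inject₁ b)))
    ... | left a  = signed (pos S) (neg S) disjoint a (∈-pos⁺ i∈S) below
      where
      disjoint : ∀ {b} → inject₁ b ∈ pos S → b ∉ neg S
      disjoint {b} b∈pos b∈neg = contradiction
        (φ.distinct-abs φS (∈-pos⁻ b∈pos) (∈-neg⁻ b∈neg)
          (from (abs-𝓑-≃ (inject₁ b ↑ˡ m) (suc m ↑ʳ b)) (trans (index-↑ˡ (inject₁ b)) (sym (index-↑ʳ b)))))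
        -- The two positions have the same absolute value but lie in different blocks, so `splitAt`
        -- tells them apart.
        λ eq → contradiction
          (trans (sym (splitAt-↑ˡ (suc m) (inject₁ b) m))
            (trans (cong (splitAt (suc m)) eq) (splitAt-↑ʳ (suc m) m b))) λ ()

      below : ∀ {j} → j ∈ supp S → j Fin.≤ a
      below j∈ with i′ , i′∈S , refl ← ∈-supp⁻ j∈ =
        subst (index i′ Fin.≤_) (index-↑ˡ a) (to (abs-𝓑-≤ i′ (a ↑ˡ m)) (max i′∈S))

    ⇒φ : IsSigned S → φ x S
    ⇒φ s = record
      { nonempty     = a ↑ˡ m , ∈-pos⁻ a∈pos
      ; distinct-abs = λ {i} {j} i∈S j∈S i≃j → index-inj i∈S j∈S (to (abs-𝓑-≃ i j) i≃j)
      ; max-positive = a ↑ˡ m , ∈-pos⁻ a∈pos ,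
          (λ {j} j∈S → from (abs-𝓑-≤ j (a ↑ˡ m)) (subst (_ Fin.≤_) (sym (index-↑ˡ a)) (max (∈-supp⁺ j∈S)))) ,
          subst (0ℝ <ℝ_) (sym (𝓑-↑ˡ x a)) (0<x a)
      }
      where
      a     = proj₁ (signed-max s)
      a∈pos = proj₁ (proj₂ (signed-max s))
      max   = proj₂ (proj₂ (signed-max s))

      index-inj : ∀ {i j} → i ∈ S → j ∈ S → index i ≡ index j → i ≡ j
      index-inj {i} {j} i∈S j∈S eq with split (suc m) i | split (suc m) j
      ... | left a  | left b  = cong (_↑ˡ m) (trans (sym (index-↑ˡ a)) (trans eq (index-↑ˡ b)))
      ... | right a | right b = cong (suc m ↑ʳ_)
              (inject₁-injective (trans (sym (index-↑ʳ a)) (trans eq (index-↑ʳ b))))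
      ... | left a  | right b with refl ← trans (sym (index-↑ˡ a)) (trans eq (index-↑ʳ b)) =
              contradiction (∈-neg⁺ j∈S) (signed-disjoint s (∈-pos⁺ i∈S))
      ... | right a | left b  with refl ← trans (sym (index-↑ˡ b)) (trans (sym eq) (index-↑ʳ a)) =
              contradiction (∈-neg⁺ i∈S) (signed-disjoint s (∈-pos⁺ j∈S))

  -- A negative element cannot equal any `x a`, because it lies strictly below it.
  V₁⇔neg≡⊥ : ∀ {k S} → V₁ x k S ⇔ (neg S ≡ ⊥ × ∣ S ∣ ≡ k)
  V₁⇔neg≡⊥ {k} {S} = mk⇔ (λ (S⊆𝓑⁺ , eq) → Empty-unique (no-neg λ {z} → S⊆𝓑⁺ {z}) , eq)
                          λ (neg≡⊥ , eq) → (λ { {z} (i , i∈S , z≃i) → positive neg≡⊥ i i∈S {z} z≃i }) , eq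
    where
    no-neg : ⟦_⟧ x S ⊆ᵖ 𝓑⁺ x → Empty (neg S)
    no-neg S⊆𝓑⁺ (b , b∈neg) =
      let a , b≃a = S⊆𝓑⁺ {𝓑 x (suc m ↑ʳ b)} (suc m ↑ʳ b , ∈-neg⁻ b∈neg , ≃-refl (𝓑 x (suc m ↑ʳ b))) in
      <ℝ⇒≄ { -ℝ x (inject₁ b)} {x a} (neg<pos {x (inject₁ b)} {x a} (0<x (inject₁ b)) (0<x a))
        (≃-sym {u = -ℝ x (inject₁ b)} {v = x a} (subst (_≃ x a) (𝓑-↑ʳ x b) b≃a))

    positive : neg S ≡ ⊥ → ∀ i → i ∈ S → ∀ {z} → z ≃ 𝓑 x i → 𝓑⁺ x z
    positive neg≡⊥ i i∈S {z} z≃i with split (suc m) i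
    ... | left a  = a , subst (z ≃_) (𝓑-↑ˡ x a) z≃i
    ... | right b = contradiction (subst (b ∈_) neg≡⊥ (∈-neg⁺ i∈S)) ∉⊥

  module _ {X Y : Subset (suc m + m)} (neg≡⊥ : neg X ≡ ⊥) where

    ∈X⇒left : ∀ {i} → i ∈ X → ∃ λ a → a ∈ pos X × 𝓑 x i ≡ x a
    ∈X⇒left {i} i∈X with split (suc m) i
    ... | left a  = a , ∈-pos⁺ i∈X , 𝓑-↑ˡ x a
    ... | right b = contradiction (subst (b ∈_) neg≡⊥ (∈-neg⁺ i∈X)) ∉⊥

    -- The inclusion is tested at the real `x a`; its witness in `Y †` has index `a` because `x` is
    -- injective up to `_≃_`.
    ⟦X⟧⊆Y†⁻ : ⟦_⟧ x X ⊆ᵖ _† x Y → pos X ⊆ supp Y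
    ⟦X⟧⊆Y†⁻ X⊆Y {a} a∈pos =
      let i , i∈Y , a≃i = X⊆Y {x a} (a ↑ˡ m , ∈-pos⁻ a∈pos ,
                                subst (x a ≃_) (sym (𝓑-↑ˡ x a)) (≃-refl (x a)))
      in subst (_∈ supp Y) (sym (x-injective (≃-≐-trans {x a} a≃i (abs-𝓑 i)))) (∈-supp⁺ i∈Y)

    ⟦X⟧⊆Y†⁺ : pos X ⊆ supp Y → ⟦_⟧ x X ⊆ᵖ _† x Y
    ⟦X⟧⊆Y†⁺ X⊆Y {z} (i , i∈X , z≃i) =
      let a , a∈pos , i≡a = ∈X⇒left i∈X ; j , j∈Y , j≡a = ∈-supp⁻ (X⊆Y a∈pos) in
      j , j∈Y , ≃-≐-trans {z} (subst (z ≃_) (trans i≡a (cong x (sym j≡a))) z≃i) (≐-sym (abs-𝓑 j))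

    Y†⊆⟦X⟧⁻ : _† x Y ⊆ᵖ ⟦_⟧ x X → supp Y ⊆ pos X
    Y†⊆⟦X⟧⁻ Y⊆X {a} a∈supp =
      let j , j∈Y , j≡a = ∈-supp⁻ a∈supp
          i , i∈X , j≃i = Y⊆X {abs (𝓑 x j)} (j , j∈Y , ≃-refl (abs (𝓑 x j)))
          a′ , a′∈pos , i≡a′ = ∈X⇒left i∈X
          ja≃a′ = ≐-≃-trans {x (index j)} {abs (𝓑 x j)} {x a′} (≐-sym (abs-𝓑 j))
                    (subst (abs (𝓑 x j) ≃_) i≡a′ j≃i)
      in subst (_∈ pos X) (trans (sym (x-injective ja≃a′)) j≡a) a′∈pos

    Y†⊆⟦X⟧⁺ : supp Y ⊆ pos X → _† x Y ⊆ᵖ ⟦_⟧ x X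
    Y†⊆⟦X⟧⁺ Y⊆X {z} (j , j∈Y , z≃j) =
      index j ↑ˡ m , ∈-pos⁻ (Y⊆X (∈-supp⁺ j∈Y)) ,
      subst (z ≃_) (sym (𝓑-↑ˡ x (index j))) (≃-≐-trans {z} z≃j (abs-𝓑 j))

-- The graph

range-unique : ∀ a b → Unique (range a b)
range-unique a b = Unique.applyUpTo⁺₁ (a +_) (suc b ∸ a) λ i<j _ eq → <⇒≢ i<j (+-cancelˡ-≡ a _ _ eq)

∈-range⁻ : ∀ {a b i} → i ∈ˡ range a b → a ≤ i × i ≤ b
∈-range⁻ {a} {b} i∈ with j , j< , refl ← ∈-applyUpTo⁻ (a +_) {n = suc b ∸ a} i∈ =
  m≤m+n a j , s≤s⁻¹ (subst (_< suc b) (+-comm j a)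
    -- Undoing the truncated subtraction requires `a ≤ suc b`, which holds because a range with a
    -- member is nonempty.
    (m≤o∸n⇒m+n≤o (suc j) (<⇒≤ (m∸n≢0⇒n<m (>⇒≢ (≤-trans (s≤s z≤n) j<)))) j<))

∈-range⁺ : ∀ {a b i} → a ≤ i → i ≤ b → i ∈ˡ range a b
∈-range⁺ {a} {b} {i} a≤i i≤b = subst (_∈ˡ range a b) (m+[n∸m]≡n a≤i)
  (∈-applyUpTo⁺ (a +_) (∸-monoˡ-< (s≤s i≤b) a≤i))

-- With all signs positive the only requirement is nonemptiness: the last element becomes `top`,
-- every earlier one `plus`. This places `V₁` among the signed subsets.
signed-positive : ∀ {m r} (p : Subset (suc m)) → ∣ p ∣ ≡ suc r → Signed p ⊥ p
signed-positive {zero}              (inside  ∷ []) _  = top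
signed-positive {suc m}             (outside ∷ p)  eq = none (signed-positive p eq)
signed-positive {suc m} {r = zero}  (inside  ∷ p)  eq with refl ← ∣p∣≡0⇒p≡⊥ {p = p} (suc-injective eq) = top
signed-positive {suc m} {r = suc r} (inside  ∷ p)  eq = plus (signed-positive p (suc-injective eq))

module Graph {m : ℕ} (x : Vector ℝ (suc m)) (0<x : ∀ i → 0ℝ <ℝ x i)
             (x-mono : ∀ {i j} → i Fin.< j → x i <ℝ x j)
             (k : ℕ) (1≤k : 1 ≤ k) (k<n : k < suc m) where

  open Components m
  open Comparison x 0<x x-mono
  open SimpleGraph (H-B x k)

  n = suc m
  k≤n = <⇒≤ k<n

  V₁⇒neg≡⊥ : ∀ {X} → V₁ x k X → neg X ≡ ⊥
  V₁⇒neg≡⊥ {X} v = proj₁ (to (V₁⇔neg≡⊥ {k} {X}) v)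

  V₁-∣pos∣ : ∀ {X} → V₁ x k X → ∣ pos X ∣ ≡ k
  V₁-∣pos∣ {X} v = begin
    ∣ pos X ∣               ≡⟨ +-identityʳ _ ⟨
    ∣ pos X ∣ + 0           ≡⟨ cong (∣ pos X ∣ +_) (∣⊥∣≡0 m) ⟨
    ∣ pos X ∣ + ∣ ⊥ {m} ∣   ≡⟨ cong (λ q → ∣ pos X ∣ + ∣ q ∣) (V₁⇒neg≡⊥ {X} v) ⟨
    ∣ pos X ∣ + ∣ neg X ∣   ≡⟨ ∣pos∣+∣neg∣ X ⟨
    ∣ X ∣                   ≡⟨ proj₂ v ⟩
    k                       ∎
    where open ≡-Reasoning

  V₁⇒≡pos++⊥ : ∀ {X} → V₁ x k X → X ≡ pos X ++ ⊥
  V₁⇒≡pos++⊥ {X} v = trans (sym (pos++neg X)) (cong (pos X ++_) (V₁⇒neg≡⊥ {X} v))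

  V₁-++⊥ : ∀ {p} → ∣ p ∣ ≡ k → V₁ x k (p ++ ⊥)
  V₁-++⊥ {p} eq = from (V₁⇔neg≡⊥ {k} {p ++ ⊥}) (neg-++ p ⊥ ,
    trans (∣p++q∣ p ⊥) (trans (cong (∣ p ∣ +_) (∣⊥∣≡0 m)) (trans (+-identityʳ _) eq)))

  V₁-supp : ∀ {X} → V₁ x k X → supp X ≡ pos X
  V₁-supp {X} v = trans (cong (λ q → pos X ∪ pad q) (V₁⇒neg≡⊥ {X} v))
    (trans (cong (pos X ∪_) (pad-⊥ m)) (∪-identityʳ (pos X)))

  V₁⇒IsSigned : ∀ {X} → V₁ x k X → IsSigned X
  V₁⇒IsSigned {X} v rewrite V₁-supp {X} v | V₁⇒neg≡⊥ {X} v =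
    signed-positive (pos X) (trans (V₁-∣pos∣ {X} v) (sym (m+[n∸m]≡n 1≤k)))

  -- Decided on `neg X` and the size, because the inclusion of predicates on reals is not decidable
  -- as it stands. Removing `V₁` from the signed `k`-subsets depends on it.
  V₁? : Decidable (V₁ x k)
  V₁? X = map-dec (mk⇔ (from (V₁⇔neg≡⊥ {k} {X})) (to (V₁⇔neg≡⊥ {k} {X})))
    (≡-dec _≟ᵇ_ (neg X) ⊥ ×-dec ∣ X ∣ ≟ k)

  card-V₁ : ∀ {Q : Pred (Subset n) 0ℓ} {c} → (∀ {p} → Q p → ∣ p ∣ ≡ k) → Q HasCardinality c →
            (λ X → V₁ x k X × Q (pos X)) HasCardinality c
  card-V₁ {Q} size Q-card = card-resp consider (card-map (_++ ⊥) (λ {p} {q} → ++-injectiveˡ p q) Q-card)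
    where
    consider : ∀ X → (∃ λ p → Q p × X ≡ p ++ ⊥) ⇔ (V₁ x k X × Q (pos X))
    consider X = mk⇔
      (λ { (p , q , refl) → V₁-++⊥ (size q) , subst Q (sym (pos-++ p ⊥)) q })
      λ (v , q) → pos X , q , V₁⇒≡pos++⊥ {X} v

  V₂⇒IsSigned : ∀ {Y} → V₂ x k Y → IsSigned Y
  V₂⇒IsSigned {Y} (φY , _) = to (φ⇔IsSigned Y) φY

  ∣supp∣ : ∀ {Y r} → IsSigned Y → ∣ Y ∣ ≡ r → ∣ supp Y ∣ ≡ r
  ∣supp∣ {Y} s eq = trans (sym (signed-∣supp∣ {S = Y} s)) eq

  -- An edge in the opposite orientation would put `X` in `V₂`, so only the inclusions between
  -- `⟦ X ⟧` and `Y †` remain, and these are inclusions of index sets.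
  ~⇔comparable : ∀ {X Y} → V₁ x k X → V₂ x k Y → X ~ Y ⇔ (pos X ⊆ supp Y ⊎ supp Y ⊆ pos X)
  ~⇔comparable {X} {Y} v₁ v₂ = mk⇔ ⇒ ⇐
    where
    neg≡⊥ = V₁⇒neg≡⊥ {X} v₁

    ⇒ : X ~ Y → pos X ⊆ supp Y ⊎ supp Y ⊆ pos X
    ⇒ (inj₁ (_ , _ , inj₁ X⊆Y))   = inj₁ (⟦X⟧⊆Y†⁻ {X} {Y} neg≡⊥ λ {z} → X⊆Y {z})
    ⇒ (inj₁ (_ , _ , inj₂ Y⊆X))   = inj₂ (Y†⊆⟦X⟧⁻ {X} {Y} neg≡⊥ λ {z} → Y⊆X {z})
    ⇒ (inj₂ (_ , (_ , ¬v₁) , _))  = contradiction v₁ ¬v₁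

    ⇐ : pos X ⊆ supp Y ⊎ supp Y ⊆ pos X → X ~ Y
    ⇐ (inj₁ X⊆Y) = inj₁ (v₁ , v₂ , inj₁ λ {z} → ⟦X⟧⊆Y†⁺ {X} {Y} neg≡⊥ X⊆Y {z})
    ⇐ (inj₂ Y⊆X) = inj₁ (v₁ , v₂ , inj₂ λ {z} → Y†⊆⟦X⟧⁺ {X} {Y} neg≡⊥ Y⊆X {z})

  ~⇒V₁ : ∀ {X Y} → V₂ x k Y → Y ~ X → V₁ x k X
  ~⇒V₁ (_ , ¬v₁) (inj₁ (v₁ , _)) = contradiction v₁ ¬v₁
  ~⇒V₁ _         (inj₂ (v₁ , _)) = v₁

  ~⇒V₂ : ∀ {X Y} → V₁ x k X → X ~ Y → V₂ x k Y
  ~⇒V₂ _  (inj₁ (_ , v₂ , _))        = v₂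
  ~⇒V₂ v₁ (inj₂ (_ , (_ , ¬v₁) , _)) = contradiction v₁ ¬v₁

  -- Degrees of the vertices of `V₂`

  module _ {Y : Sub𝓑 x} (v₂ : V₂ x k Y) where

    -- Taking `pos` identifies the neighbours of `Y` with the `k`-sets comparable to `supp Y`; `Q`
    -- is the single inclusion to which comparability reduces at the given sizes.
    degree-V₂ : ∀ {Q : Pred (Subset n) 0ℓ} {d} → (λ p → Q p × ∣ p ∣ ≡ k) HasCardinality d →
                (∀ {p} → ∣ p ∣ ≡ k → p ⊆ supp Y ⊎ supp Y ⊆ p → Q p) →
                (∀ {p} → Q p → p ⊆ supp Y ⊎ supp Y ⊆ p) → HasDegree Y d
    degree-V₂ Q-card comparable⇒Q Q⇒comparable = card-resp
      (λ X → mk⇔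
        (λ (v₁ , q , _) → ~-sym {X} {Y} (from (~⇔comparable {X} {Y} v₁ v₂) (Q⇒comparable q)))
        (λ Y~X → let v₁ = ~⇒V₁ {X} {Y} v₂ Y~X ; eq = V₁-∣pos∣ {X} v₁ in
          v₁ , comparable⇒Q eq (to (~⇔comparable {X} {Y} v₁ v₂) (~-sym {Y} {X} Y~X)) , eq))
      (card-V₁ proj₂ Q-card)

    -- A `k`-set contained in a support of at most `k` elements equals it, so the neighbours are
    -- exactly the `k`-sets containing the support.
    degree-below : ∀ {r} → ∣ Y ∣ ≡ r → r ≤ k → HasDegree Y ((n ∸ r) C (k ∸ r))
    degree-below {r} ∣Y∣≡r r≤k with refl ← ∣supp∣ {Y} (V₂⇒IsSigned {Y} v₂) ∣Y∣≡r =
      degree-V₂ {Q = supp Y ⊆_} (card-⊇ (supp Y) r≤k k≤n) ⊇supp inj₂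
      where
      ⊇supp : ∀ {p} → ∣ p ∣ ≡ k → p ⊆ supp Y ⊎ supp Y ⊆ p → supp Y ⊆ p
      ⊇supp ∣p∣≡k (inj₁ p⊆Y) =
        ⊆-reflexive (sym (⊆∧∣≥∣⇒≡ p⊆Y (≤-trans r≤k (≤-reflexive (sym ∣p∣≡k)))))
      ⊇supp ∣p∣≡k (inj₂ Y⊆p) = Y⊆p

    degree-above : ∀ {r} → ∣ Y ∣ ≡ r → k ≤ r → HasDegree Y (r C k)
    degree-above {r} ∣Y∣≡r k≤r with refl ← ∣supp∣ {Y} (V₂⇒IsSigned {Y} v₂) ∣Y∣≡r =
      degree-V₂ {Q = _⊆ supp Y} (card-⊆ (supp Y) k) ⊆supp inj₁
      where
      ⊆supp : ∀ {p} → ∣ p ∣ ≡ k → p ⊆ supp Y ⊎ supp Y ⊆ p → p ⊆ supp Y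
      ⊆supp ∣p∣≡k (inj₁ p⊆Y) = p⊆Y
      ⊆supp ∣p∣≡k (inj₂ Y⊆p) =
        ⊆-reflexive (sym (⊆∧∣≥∣⇒≡ Y⊆p (≤-trans (≤-reflexive ∣p∣≡k) k≤r)))

    -- The only candidate counted by `k C k` is the all-positive set on `supp Y`.
    degree-k : ∣ Y ∣ ≡ k → HasDegree Y 1
    degree-k eq = card-≡ (nCn≡1 k) (degree-above eq ≤-refl)

  -- Multiplicities of the degrees

  card-all-V₁ : V₁ x k HasCardinality (n C k)
  card-all-V₁ = card-resp (λ X → mk⇔ proj₁ λ v → v , V₁-∣pos∣ {X} v) (card-V₁ id (card-all n k))

  card-IsSigned-size : ∀ {r} → 1 ≤ r →
    (λ Y → IsSigned Y × ∣ supp Y ∣ ≡ r) HasCardinality (2 ^ (r ∸ 1) * (n C r))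
  card-IsSigned-size {r} 1≤r = card-IsSigned 1≤r (card-all n r) id

  card-V₂-size≢k : ∀ {r} → 1 ≤ r → r ≢ k →
    (λ Y → V₂ x k Y × ∣ Y ∣ ≡ r) HasCardinality (2 ^ (r ∸ 1) * (n C r))
  card-V₂-size≢k {r} 1≤r r≢k = card-resp consider (card-IsSigned-size 1≤r)
    where
    consider : ∀ Y → (IsSigned Y × ∣ supp Y ∣ ≡ r) ⇔ (V₂ x k Y × ∣ Y ∣ ≡ r)
    consider Y = mk⇔
      (λ (s , eq) → let ∣Y∣≡r = trans (signed-∣supp∣ {S = Y} s) eq in
        (from (φ⇔IsSigned Y) s , λ v → r≢k (trans (sym ∣Y∣≡r) (proj₂ v))) , ∣Y∣≡r)
      λ (v₂ , eq) → let s = V₂⇒IsSigned {Y} v₂ in s , ∣supp∣ {Y} s eq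

  -- Among the signed `k`-subsets the members of `V₁` are the all-positive ones, one for each
  -- support, and these are removed.
  card-V₂-size≡k : (λ Y → V₂ x k Y × ∣ Y ∣ ≡ k) HasCardinality ((2 ^ (k ∸ 1) ∸ 1) * (n C k))
  card-V₂-size≡k = card-≡ count (card-resp consider
    (card-∖ V₁? (λ X v → V₁⇒IsSigned {X} v , trans (cong ∣_∣ (V₁-supp {X} v)) (V₁-∣pos∣ {X} v))
            (card-IsSigned-size 1≤k) card-all-V₁))
    where
    consider : ∀ Y → ((IsSigned Y × ∣ supp Y ∣ ≡ k) × ¬ V₁ x k Y) ⇔ (V₂ x k Y × ∣ Y ∣ ≡ k)
    consider Y = mk⇔
      (λ ((s , eq) , ¬v₁) → (from (φ⇔IsSigned Y) s , ¬v₁) , trans (signed-∣supp∣ {S = Y} s) eq)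
      λ (v₂ , eq) → let s = V₂⇒IsSigned {Y} v₂ in (s , ∣supp∣ {Y} s eq) , proj₂ v₂

    count : 2 ^ (k ∸ 1) * (n C k) ∸ n C k ≡ (2 ^ (k ∸ 1) ∸ 1) * (n C k)
    count = trans (cong (2 ^ (k ∸ 1) * (n C k) ∸_) (sym (*-identityˡ (n C k))))
      (sym (*-distribʳ-∸ (n C k) (2 ^ (k ∸ 1)) 1))

  -- Degree of a vertex of `V₁`

  module _ {X : Sub𝓑 x} (v₁ : V₁ x k X) where

    -- Supports equal to `pos X` belong to `Below`, so `Above` starts at `t = 1` and the two classes
    -- are disjoint. Excluding `X` alone suffices to stay inside `V₂`.
    Below Above : Pred (Sub𝓑 x) 0ℓ
    Below Y = (IsSigned Y × supp Y ⊆ pos X) × Y ≢ X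
    Above Y = ∃ λ t → t ∈ˡ range 1 (n ∸ k) × IsSigned Y × pos X ⊆ supp Y × ∣ supp Y ∣ ≡ k + t

    card-Below : Below HasCardinality (signedCount k ∸ 1)
    card-Below = card-∖ (λ Y → ≡-dec _≟ᵇ_ Y X)
      (λ { _ refl → V₁⇒IsSigned {X} v₁ , λ {_} → ⊆-reflexive (V₁-supp {X} v₁) })
      (card-resp consider (card-⋃ (λ s → 2 ^ (s ∸ 1) * (k C s)) (range 1 k) (range-unique 1 k)
        (λ {s} s∈ → card-IsSigned (proj₁ (∈-range⁻ s∈))
          (card-≡ (cong (_C s) (V₁-∣pos∣ {X} v₁)) (card-⊆ (pos X) s)) proj₂)
        λ { _ (_ , _ , eq) (_ , _ , eq′) → trans (sym eq) eq′ }))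
      (card-singleton X λ _ → mk⇔ id id)
      where
      consider : ∀ Y → (∃ λ s → s ∈ˡ range 1 k × IsSigned Y × supp Y ⊆ pos X × ∣ supp Y ∣ ≡ s)
                       ⇔ (IsSigned Y × supp Y ⊆ pos X)
      consider Y = mk⇔ (λ (_ , _ , s , Y⊆X , _) → s , λ {_} → Y⊆X)
        λ (s , Y⊆X) → ∣ supp Y ∣ , ∈-range⁺ (n≢0⇒n>0 (signed-nonempty s))
          (≤-trans (p⊆q⇒∣p∣≤∣q∣ Y⊆X) (≤-reflexive (V₁-∣pos∣ {X} v₁))) , s , (λ {_} → Y⊆X) , refl

    card-Above : Above HasCardinality
                 sum (map (λ t → 2 ^ (k + t ∸ 1) * ((n ∸ k) C t)) (range 1 (n ∸ k)))
    card-Above = card-⋃ _ (range 1 (n ∸ k)) (range-unique 1 (n ∸ k))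
      (λ {t} t∈ → card-IsSigned (≤-trans 1≤k (m≤m+n k t))
        (card-≡ (cong₂ _C_ (cong (n ∸_) (V₁-∣pos∣ {X} v₁)) (trans (cong (k + t ∸_) (V₁-∣pos∣ {X} v₁)) (m+n∸m≡n k t)))
          (card-⊇ (pos X) (≤-trans (≤-reflexive (V₁-∣pos∣ {X} v₁)) (m≤m+n k t))
            (≤-trans (+-monoʳ-≤ k (proj₂ (∈-range⁻ t∈))) (≤-reflexive (m+[n∸m]≡n k≤n)))))
        proj₂)
      λ { {t} {t′} _ (_ , _ , eq) (_ , _ , eq′) → +-cancelˡ-≡ k t t′ (trans (sym eq) eq′) }

    neighbours : ∀ Y → (Below Y ⊎ Above Y) ⇔ X ~ Y
    neighbours Y = mk⇔ ⇒ ⇐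
      where
      ⇒ : Below Y ⊎ Above Y → X ~ Y
      ⇒ (inj₁ ((s , Y⊆X) , Y≢X)) =
        from (~⇔comparable {X} {Y} v₁ (from (φ⇔IsSigned Y) s , ¬v₁)) (inj₂ Y⊆X)
        where
        -- A member of `V₁` with support inside `pos X` fills all of it for reasons of size and has
        -- no negative element, so it is `X`.
        ¬v₁ : ¬ V₁ x k Y
        ¬v₁ v = Y≢X (trans (V₁⇒≡pos++⊥ {Y} v) (trans (cong (_++ ⊥) pos≡) (sym (V₁⇒≡pos++⊥ {X} v₁))))
          where
          pos≡ : pos Y ≡ pos X
          pos≡ = ⊆∧∣≥∣⇒≡ (subst (_⊆ pos X) (V₁-supp {Y} v) Y⊆X)
                   (≤-reflexive (trans (V₁-∣pos∣ {X} v₁) (sym (V₁-∣pos∣ {Y} v))))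
      ⇒ (inj₂ (t , t∈ , s , X⊆Y , eq)) =
        from (~⇔comparable {X} {Y} v₁ (from (φ⇔IsSigned Y) s , ¬v₁)) (inj₁ X⊆Y)
        where
        ¬v₁ : ¬ V₁ x k Y
        ¬v₁ v = m+1+n≢m k (begin
          k + suc (t ∸ 1)   ≡⟨ cong (k +_) (m+[n∸m]≡n (proj₁ (∈-range⁻ t∈))) ⟩
          k + t             ≡⟨ eq ⟨
          ∣ supp Y ∣        ≡⟨ cong ∣_∣ (V₁-supp {Y} v) ⟩
          ∣ pos Y ∣         ≡⟨ V₁-∣pos∣ {Y} v ⟩
          k                 ∎)
          where open ≡-Reasoning

      ⇐ : X ~ Y → Below Y ⊎ Above Y
      ⇐ X~Y = classify (to (~⇔comparable {X} {Y} v₁ v₂) X~Y)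
        where
        v₂ = ~⇒V₂ {X} {Y} v₁ X~Y
        s  = V₂⇒IsSigned {Y} v₂

        below : supp Y ⊆ pos X → Below Y
        below Y⊆X = (s , λ {_} → Y⊆X) , λ { refl → proj₂ v₂ v₁ }

        classify : pos X ⊆ supp Y ⊎ supp Y ⊆ pos X → Below Y ⊎ Above Y
        classify (inj₂ Y⊆X) = inj₁ (below Y⊆X)
        classify (inj₁ X⊆Y) with ∣ supp Y ∣ ≤? k
        -- A support that contains `pos X` and has at most `k` elements is `pos X` itself, so `Y` is
        -- counted in `Below`.
        ... | yes Y≤k = inj₁ (below (⊆-reflexive (sym (⊆∧∣≥∣⇒≡ X⊆Y
                          (≤-trans Y≤k (≤-reflexive (sym (V₁-∣pos∣ {X} v₁))))))))
        ... | no  Y≰k = inj₂ (∣ supp Y ∣ ∸ k ,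
                          ∈-range⁺ (m<n⇒0<n∸m (≰⇒> Y≰k)) (∸-monoˡ-≤ k (∣p∣≤n (supp Y))) ,
                          s , (λ {_} → X⊆Y) , sym (m+[n∸m]≡n (<⇒≤ (≰⇒> Y≰k))))

    degree-V₁ : HasDegree X (d-V₁ n k)
    degree-V₁ = card-resp neighbours (card-⊎ card-Below card-Above disjoint)
      where
      disjoint : ∀ Y → Below Y → ¬ Above Y
      disjoint Y ((_ , Y⊆X) , _) (t , t∈ , _ , _ , eq) = <⇒≱ (m<m+n k (proj₁ (∈-range⁻ t∈)))
        (subst (_≤ k) eq (≤-trans (p⊆q⇒∣p∣≤∣q∣ Y⊆X) (≤-reflexive (V₁-∣pos∣ {X} v₁))))

  -- The degree sequence

  1≤∣V₂∣ : ∀ {Y} → V₂ x k Y → 1 ≤ ∣ Y ∣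
  1≤∣V₂∣ {Y} v₂ = let s = V₂⇒IsSigned {Y} v₂ in
    subst (1 ≤_) (sym (signed-∣supp∣ {S = Y} s)) (n≢0⇒n>0 (signed-nonempty s))

  ∣V₂∣≤n : ∀ {Y} → V₂ x k Y → ∣ Y ∣ ≤ n
  ∣V₂∣≤n {Y} v₂ = subst (_≤ n) (sym (signed-∣supp∣ {S = Y} (V₂⇒IsSigned {Y} v₂))) (∣p∣≤n (supp Y))

  -- The blocks are nested as in `degreeList`. Those of `V₂` are disjoint because their sizes
  -- differ, and `V₁` is excluded from `V₂` by definition.
  labelled-degrees : Labelled HasDegree IsVertex (degreeList n k)
  labelled-degrees = labelled-resp by-size
    (labelled-⊎ (labelled-replicate card-all-V₁ λ X v₁ → degree-V₁ {X} v₁)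
    (labelled-⊎ (labelled-⋃ _ (range 1 (k ∸ 1)) (range-unique 1 (k ∸ 1))
                  (λ {r} r∈ →
                    labelled-replicate (card-V₂-size≢k (proj₁ (∈-range⁻ r∈)) (<⇒≢ (r<k r∈)))
                      λ Y (v₂ , eq) → degree-below {Y} v₂ eq (<⇒≤ (r<k r∈)))
                  same-size)
    (labelled-⊎ (labelled-replicate card-V₂-size≡k λ Y (v₂ , eq) → degree-k {Y} v₂ eq)
                (labelled-⋃ _ (range (suc k) n) (range-unique (suc k) n)
                  (λ {r} r∈ → let k<r = proj₁ (∈-range⁻ {suc k} {n} r∈) in
                    labelled-replicate (card-V₂-size≢k (≤-trans (s≤s z≤n) k<r) (>⇒≢ k<r))
                      λ Y (v₂ , eq) → degree-above {Y} v₂ eq (<⇒≤ k<r))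
                  same-size)
                λ { Y (_ , eq) (r , r∈ , _ , eq′) → <⇒≢ (proj₁ (∈-range⁻ {suc k} {n} r∈)) (trans (sym eq) eq′) })
                λ { Y (r , r∈ , _ , eq) (inj₁ (_ , eq′)) → <⇒≢ (r<k r∈) (trans (sym eq) eq′)
                  ; Y (r , r∈ , _ , eq) (inj₂ (r′ , r′∈ , _ , eq′)) →
                      <⇒≢ (<-trans (r<k r∈) (proj₁ (∈-range⁻ {suc k} {n} r′∈))) (trans (sym eq) eq′) })
                λ { Y v₁ (inj₁ (_ , _ , v₂ , _)) → proj₂ v₂ v₁
                  ; Y v₁ (inj₂ (inj₁ (v₂ , _))) → proj₂ v₂ v₁
                  ; Y v₁ (inj₂ (inj₂ (_ , _ , v₂ , _))) → proj₂ v₂ v₁ })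
    where
    OfSize : ℕ → Pred (Sub𝓑 x) 0ℓ
    OfSize r Y = V₂ x k Y × ∣ Y ∣ ≡ r

    same-size : ∀ {r r′} Y → OfSize r Y → OfSize r′ Y → r ≡ r′
    same-size _ (_ , eq) (_ , eq′) = trans (sym eq) eq′

    r<k : ∀ {r} → r ∈ˡ range 1 (k ∸ 1) → r < k
    r<k r∈ = ≤-trans (s≤s (proj₂ (∈-range⁻ r∈))) (≤-reflexive (m+[n∸m]≡n 1≤k))

    by-size : ∀ Y → (V₁ x k Y ⊎ (∃ λ r → r ∈ˡ range 1 (k ∸ 1) × OfSize r Y) ⊎ OfSize k Y ⊎
                     (∃ λ r → r ∈ˡ range (suc k) n × OfSize r Y)) ⇔ IsVertex Y
    by-size Y = mk⇔
      (λ { (inj₁ v₁) → inj₁ v₁ ; (inj₂ (inj₁ (_ , _ , v₂ , _))) → inj₂ v₂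
         ; (inj₂ (inj₂ (inj₁ (v₂ , _)))) → inj₂ v₂ ; (inj₂ (inj₂ (inj₂ (_ , _ , v₂ , _)))) → inj₂ v₂ })
      λ { (inj₁ v₁) → inj₁ v₁ ; (inj₂ v₂) → inj₂ (size v₂) }
      where
      size : V₂ x k Y → (∃ λ r → r ∈ˡ range 1 (k ∸ 1) × OfSize r Y) ⊎ OfSize k Y ⊎
                        (∃ λ r → r ∈ˡ range (suc k) n × OfSize r Y)
      size v₂ with <-cmp ∣ Y ∣ k
      ... | tri< Y<k _ _ = inj₁ (∣ Y ∣ , ∈-range⁺ (1≤∣V₂∣ {Y} v₂) (∸-monoˡ-≤ 1 Y<k) , v₂ , refl)
      ... | tri≈ _ Y≡k _ = inj₂ (inj₁ (v₂ , Y≡k))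
      ... | tri> _ _ k<Y = inj₂ (inj₂ (∣ Y ∣ , ∈-range⁺ k<Y (∣V₂∣≤n {Y} v₂) , v₂ , refl))

  -- Degrees are unique, so any two lists of all degrees are permutations of each other; conversely
  -- a rearrangement of the degrees is matched by rearranging the vertices.
  degree-sequence : ∀ ds → IsDegreeSequence ds ⇔ (NonIncreasing ds × ds ↭ degreeList n k)
  degree-sequence ds = mk⇔
    (map₂ λ lab → labelled-unique card-unique lab labelled-degrees)
    (map₂ λ ds↭ → labelled-↭ (↭-sym ds↭) labelled-degrees)

mainTheorem10 : (n k : ℕ) → 2 ≤ n → 1 ≤ k → k < n →
    (x : Vector ℝ n) →
    (∀ i → 0ℝ <ℝ x i) →
    (∀ {i j} → i Fin.< j → x i <ℝ x j) →
    let open SimpleGraph (H-B x k) in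
    ( (∀ X → V₁ x k X → HasDegree X (d-V₁ n k))
    × d-V₁ n k ≡ (3 ^ k ∸ 3) / 2 + 2 ^ (k ∸ 1) * (3 ^ (n ∸ k) ∸ 1)
    × V₁ x k HasCardinality (n C k) )
    × (∀ r → 1 ≤ r → r < k →
    (∀ Y → V₂ x k Y → ∣ Y ∣ ≡ r → HasDegree Y ((n ∸ r) C (k ∸ r)))
    × (λ Y → V₂ x k Y × ∣ Y ∣ ≡ r) HasCardinality (2 ^ (r ∸ 1) * (n C r)))
    × ( (∀ Y → V₂ x k Y → ∣ Y ∣ ≡ k → HasDegree Y 1)
    × (λ Y → V₂ x k Y × ∣ Y ∣ ≡ k) HasCardinality ((2 ^ (k ∸ 1) ∸ 1) * (n C k)) )
    × (∀ r → k < r → r ≤ n →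
    (∀ Y → V₂ x k Y → ∣ Y ∣ ≡ r → HasDegree Y (r C k))
    × (λ Y → V₂ x k Y × ∣ Y ∣ ≡ r) HasCardinality (2 ^ (r ∸ 1) * (n C r)))
    × (∀ ds → IsDegreeSequence ds ⇔ (NonIncreasing ds × ds ↭ degreeList n k))
mainTheorem10 (suc m) k _ 1≤k k<n x 0<x x-mono =
    ((λ X v₁ → degree-V₁ {X} v₁) , d-V₁-closed (suc m) k 1≤k , card-all-V₁)
  , (λ r 1≤r r<k → (λ Y v₂ eq → degree-below {Y} v₂ eq (<⇒≤ r<k)) , card-V₂-size≢k 1≤r (<⇒≢ r<k))
  , ((λ Y v₂ eq → degree-k {Y} v₂ eq) , card-V₂-size≡k)
  , (λ r k<r _ → (λ Y v₂ eq → degree-above {Y} v₂ eq (<⇒≤ k<r)) ,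
                 card-V₂-size≢k (≤-trans (s≤s z≤n) k<r) (>⇒≢ k<r))
  , degree-sequence
  where open Graph x 0<x x-mono k 1≤k k<n
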